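{- Let $p=p(n)\in[0,1]$ satisfy $p\gg n^{ -1}$, i.e. $n\,p(n)\to\infty$ as $n\to\infty$, and let $G\in\mathcal{G}(n,p)$. Then asymptotically almost surely $$\operatorname{td}(G)=n-O\left(\sqrt{\frac{n}{p}}\right),$$ that is, there is a constant $C>0$ such that $\Pr\left(n-C\sqrt{n/p}\le \operatorname{td}(G)\le n\right)\to 1$ as $n\to\infty$.
   Context: All graphs are finite and simple. $\mathcal{G}(n,p)$ is the Erdős–Rényi random graph on $n$ labeled vertices in which each pair of vertices is an edge independently with probability $p$. A property holds asymptotically almost surely (a.a.s.) if its probability tends to $1$ as $n\to\infty$. Tree-depth: the closure of a rooted tree $T$ is the graph on the vertex set of $T$ in which two distinct vertices are adjacent iff one is an ancestor of the other in $T$. A rooted forest is a disjoint union of rooted trees, and its closure is the disjoint union of the closures of its trees. The height of a rooted tree is the maximum number of vertices on a path from the root to a vertex, and the height of a rooted forest is the maximum height of its trees. The tree-depth $\operatorname{td}(G)$ of a graph $G$ is the minimum height of a rooted forest $F$ on the vertex set $V(G)$ such that $G$ is a subgraph of the closure of $F$. (With this convention $\operatorname{td}(K_n)=n$.) -}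

module Defs where

open import Algebra.Bundles using (CommutativeRing)
open import Algebra.Structures using (IsCommutativeRing)
import Algebra.Properties.Monoid.Mult as Mult
import Algebra.Properties.Ring as RingProperties
open import Data.Empty using (⊥; ⊥-elim)
open import Data.Fin.Base using (Fin; zero; suc; toℕ; inject₁)
import Data.Fin.Base as Fin
import Data.Fin.Induction as Fin
import Data.Fin.Properties as Fin
open import Data.Fin.Subset using (Subset; inside; outside; _∈_)
open import Data.Fin.Subset.Properties using (_∈?_)
open import Data.List.Base using (List; []; _∷_; [_]; map; _++_; foldr; filter; allFin; cartesianProductWith)
open import Data.List.Extrema.Nat using (max; max≤v⁺; xs≤max)
open import Data.List.Membership.Propositional.Properties using (∈-map⁺; ∈-allFin)
import Data.List.Relation.Unary.All as All
import Data.List.Relation.Unary.All.Properties as All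
open import Data.Maybe.Base using (Maybe; nothing; just)
open import Data.Maybe.Properties using (just-injective)
open import Data.Nat.Base as ℕ using (ℕ; zero; suc; z≤n; s≤s)
import Data.Nat.Properties as ℕ
open import Data.Product.Base using (∃; ∃-syntax; _×_; _,_; proj₁; proj₂)
open import Data.Sum.Base using (_⊎_; inj₁; inj₂)
open import Data.Vec.Base as Vec using (Vec; []; _∷_; lookup; tabulate)
open import Data.Vec.Properties using (lookup∘tabulate)
open import Function.Base using (_∘_)
open import Level using (0ℓ)
open import Relation.Binary.Bundles using (DecTotalOrder)
open import Relation.Binary.Core using (Rel)
open import Relation.Binary.Definitions using (tri<; tri≈; tri>)
open import Relation.Binary.PropositionalEquality.Core using (_≡_; refl; sym; trans; cong; subst)
open import Relation.Binary.Structures using (IsDecTotalOrder)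
import Relation.Binary.Construct.NonStrictToStrict as ToStrict
import Relation.Binary.Properties.DecTotalOrder as DecTotalOrderProperties
open import Relation.Nullary.Decidable using (Dec; yes; no; map′; _×-dec_; _⊎-dec_; _→-dec_)
open import Relation.Nullary.Negation using (¬_)
open import Relation.Unary using (Pred; Decidable)

------------------------------------------------------------------------
-- The real numbers

-- The library has no real numbers.  Complete ordered fields are unique up
-- to isomorphism, so a statement about all of them is a statement about ℝ.
-- This is ℝ of classical mathematics: the order is decidable, and together
-- with completeness this yields excluded middle for small types.  (Take the
-- supremum of {0} ∪ {1 | A} and compare it with 0.)

record CompleteOrderedField : Set₁ where
  infix  8 _⁻¹ -_
  infixl 7 _*_
  infixl 6 _+_
  infix  4 _≈_ _≤_
  field
    Carrier           : Set
    _≈_ _≤_           : Rel Carrier 0ℓ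
    _+_ _*_           : Carrier → Carrier → Carrier
    -_ _⁻¹            : Carrier → Carrier
    0# 1#             : Carrier
    isCommutativeRing : IsCommutativeRing _≈_ _+_ _*_ -_ 0# 1#
    isDecTotalOrder   : IsDecTotalOrder _≈_ _≤_
    0≉1               : ¬ 0# ≈ 1#

    -- The inverse is total, with an unspecified value at 0#.
    ⁻¹-cong           : ∀ {x y} → x ≈ y → x ⁻¹ ≈ y ⁻¹
    ⁻¹-inverseʳ       : ∀ {x} → ¬ x ≈ 0# → x * x ⁻¹ ≈ 1#

    +-monoˡ-≤         : ∀ z {x y} → x ≤ y → x + z ≤ y + z
    *-nonNegative     : ∀ {x y} → 0# ≤ x → 0# ≤ y → 0# ≤ x * y

  open ToStrict _≈_ _≤_ public using (_<_)

  UpperBound : Pred Carrier 0ℓ → Carrier → Set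
  UpperBound P u = ∀ {y} → P y → y ≤ u

  -- Leastness is put positively: nothing below s bounds P, because some
  -- element of P exceeds it.  Classically this is the least upper bound.
  IsSupremum : Pred Carrier 0ℓ → Carrier → Set
  IsSupremum P s = UpperBound P s × (∀ {y} → y < s → ∃[ x ] P x × y < x)

  field
    complete          : ∀ (P : Pred Carrier 0ℓ) → ∃ P → ∃ (UpperBound P) → ∃ (IsSupremum P)

  commutativeRing : CommutativeRing 0ℓ 0ℓ
  commutativeRing = record { isCommutativeRing = isCommutativeRing }

  decTotalOrder : DecTotalOrder 0ℓ 0ℓ 0ℓ
  decTotalOrder = record { isDecTotalOrder = isDecTotalOrder }

  open IsDecTotalOrder isDecTotalOrder public using (_≤?_; _≟_)

  infixl 7 _/_
  infixl 6 _-_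

  _-_ _/_ : Carrier → Carrier → Carrier
  x - y = x + - y
  x / y = x * y ⁻¹

  fromℕ : ℕ → Carrier
  fromℕ n = n · 1#
    where open Mult (CommutativeRing.+-monoid commutativeRing) renaming (_×_ to _·_)

  private
    module R = CommutativeRing commutativeRing
    module O = DecTotalOrder decTotalOrder
    open RingProperties R.ring using (-‿distribˡ-*; -‿involutive; -1*x≈-x)

    ≰⇒≥ : ∀ {x y} → ¬ x ≤ y → y ≤ x
    ≰⇒≥ = proj₁ ∘ DecTotalOrderProperties.≰⇒> decTotalOrder

    0≤y-x : ∀ {x y} → x ≤ y → 0# ≤ y - x
    0≤y-x {x} x≤y = O.≤-respˡ-≈ (R.-‿inverseʳ x) (+-monoˡ-≤ (- x) x≤y)

    x≤y-from-diff : ∀ {x y} → 0# ≤ y - x → x ≤ y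
    x≤y-from-diff {x} {y} 0≤d = O.≤-respˡ-≈ (R.+-identityˡ x) (O.≤-respʳ-≈
      (R.trans (R.+-assoc y (- x) x) (R.trans (R.+-congˡ (R.-‿inverseˡ x)) (R.+-identityʳ y)))
      (+-monoˡ-≤ x 0≤d))

    *-monoˡ-≤ : ∀ {x y z} → 0# ≤ z → x ≤ y → x * z ≤ y * z
    *-monoˡ-≤ {x} {y} {z} 0≤z x≤y = x≤y-from-diff (O.≤-respʳ-≈ eq (*-nonNegative (0≤y-x x≤y) 0≤z))
      where
      eq : (y - x) * z ≈ y * z - x * z
      eq = R.trans (R.distribʳ z y (- x)) (R.+-congˡ (R.sym (-‿distribˡ-* x z)))

  -- The alternative y ≤ 0# makes √ total; for 0# ≤ x it does not change
  -- the supremum.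
  RootLowerBound : Carrier → Pred Carrier 0ℓ
  RootLowerBound x y = y ≤ 0# ⊎ y * y ≤ x

  private
    0≤1 : 0# ≤ 1#
    0≤1 with 0# ≤? 1#
    ... | yes 0≤1 = 0≤1
    ... | no  0≰1 = O.≤-respʳ-≈ (R.trans (-1*x≈-x (- 1#)) (-‿involutive 1#))
                                (*-nonNegative 0≤-1 0≤-1)
      where
      0≤-1 : 0# ≤ - 1#
      0≤-1 = O.≤-respʳ-≈ (R.+-identityˡ (- 1#)) (0≤y-x (≰⇒≥ 0≰1))

    x≤x² : ∀ {x} → 1# ≤ x → x ≤ x * x
    x≤x² {x} 1≤x = O.≤-respˡ-≈ (R.*-identityˡ x) (*-monoˡ-≤ (O.trans 0≤1 1≤x) 1≤x)

    rootLowerBound-bounded : ∀ x → ∃ (UpperBound (RootLowerBound x))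
    rootLowerBound-bounded x with 1# ≤? x
    ... | yes 1≤x = x , bounded
      where
      bounded : UpperBound (RootLowerBound x) x
      bounded (inj₁ y≤0) = O.trans y≤0 (O.trans 0≤1 1≤x)
      bounded {y} (inj₂ y²≤x) with y ≤? 1#
      ... | yes y≤1 = O.trans y≤1 1≤x
      ... | no  y≰1 = O.trans (x≤x² (≰⇒≥ y≰1)) y²≤x
    ... | no  1≰x = 1# , bounded
      where
      bounded : UpperBound (RootLowerBound x) 1#
      bounded (inj₁ y≤0) = O.trans y≤0 0≤1
      bounded {y} (inj₂ y²≤x) with y ≤? 1#
      ... | yes y≤1 = y≤1
      ... | no  y≰1 = O.trans (x≤x² (≰⇒≥ y≰1)) (O.trans y²≤x (≰⇒≥ 1≰x))

  √-supremum : ∀ x → ∃ (IsSupremum (RootLowerBound x))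
  √-supremum x = complete (RootLowerBound x) (0# , inj₁ O.refl) (rootLowerBound-bounded x)

  √ : Carrier → Carrier
  √ x = proj₁ (√-supremum x)

  infix 4 _⟶_ _⟶∞

  _⟶∞ : (ℕ → Carrier) → Set
  a ⟶∞ = ∀ K → ∃[ N ] ∀ n → N ℕ.≤ n → K ≤ a n

  _⟶_ : (ℕ → Carrier) → Carrier → Set
  a ⟶ L = ∀ ε → 0# < ε → ∃[ N ] ∀ n → N ℕ.≤ n → L - ε < a n × a n < L + ε

------------------------------------------------------------------------
-- Graphs

-- G ▷ A adds to G a new vertex, numbered zero, with neighbourhood A; the
-- old vertex i becomes suc i.  Every simple graph on the vertex set Fin n
-- arises in exactly one way.

infixl 5 _▷_

data Graph : ℕ → Set where
  ∅   : Graph 0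
  _▷_ : ∀ {n} → Graph n → Subset n → Graph (suc n)

Adj : ∀ {n} → Graph n → Fin n → Fin n → Set
Adj (G ▷ A) zero    zero    = ⊥
Adj (G ▷ A) zero    (suc j) = j ∈ A
Adj (G ▷ A) (suc i) zero    = i ∈ A
Adj (G ▷ A) (suc i) (suc j) = Adj G i j

adj? : ∀ {n} (G : Graph n) u v → Dec (Adj G u v)
adj? (G ▷ A) zero    zero    = no λ ()
adj? (G ▷ A) zero    (suc j) = j ∈? A
adj? (G ▷ A) (suc i) zero    = i ∈? A
adj? (G ▷ A) (suc i) (suc j) = adj? G i j

------------------------------------------------------------------------
-- Rooted forests and tree-depth

ParentMap : ℕ → Set
ParentMap n = Vec (Maybe (Fin n)) n

module _ {n} (parent : ParentMap n) where

  -- RootPath v k : following parents from v ends in a root, and the path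
  -- has k vertices.
  data RootPath : Fin n → ℕ → Set where
    root  : ∀ {v} → lookup parent v ≡ nothing → RootPath v 1
    child : ∀ {v u k} → lookup parent v ≡ just u → RootPath u k → RootPath v (suc k)

  -- Ancestor u v : u is a proper ancestor of v.
  data Ancestor (u : Fin n) : Fin n → Set where
    here  : ∀ {v} → lookup parent v ≡ just u → Ancestor u v
    there : ∀ {v w} → lookup parent v ≡ just w → Ancestor u w → Ancestor u v

-- A parent map describes a forest iff it has no cycles, that is, iff every
-- vertex is connected to a root.

record RootedForest (n : ℕ) : Set where
  field
    parent : ParentMap n
    rooted : ∀ v → ∃ (RootPath parent v)

  depth : Fin n → ℕ
  depth v = proj₁ (rooted v)

  height : ℕ
  height = max 0 (map depth (allFin n))

open RootedForest public using (height)

-- Distinctness need not be required: proper ancestors are distinct.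
ClosureAdj : ∀ {n} → RootedForest n → Fin n → Fin n → Set
ClosureAdj F u v = Ancestor parent u v ⊎ Ancestor parent v u
  where open RootedForest F

infix 4 _⊑closure_

_⊑closure_ : ∀ {n} → Graph n → RootedForest n → Set
G ⊑closure F = ∀ u v → Adj G u v → ClosureAdj F u v

IsTreeDepth : ∀ {n} → Graph n → ℕ → Set
IsTreeDepth G d = (∃[ F ] G ⊑closure F × height F ≡ d)
                × (∀ F → G ⊑closure F → d ℕ.≤ height F)

private

  HasHeight≤ : ∀ {n} → Graph n → ℕ → Set
  HasHeight≤ G h = ∃[ F ] G ⊑closure F × height F ℕ.≤ h

  module _ {n} (parent : ParentMap n) where

    rootPath? : ∀ h v → Dec (∃[ k ] RootPath parent v k × k ℕ.≤ h)
    rootPath? zero    v = no λ { (_ , root _ , ()) ; (_ , child _ _ , ()) }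
    rootPath? (suc h) v with lookup parent v in eq
    ... | nothing = yes (1 , root eq , s≤s z≤n)
    ... | just u with rootPath? h u
    ...   | yes (k , path , k≤h) = yes (suc k , child eq path , s≤s k≤h)
    ...   | no  ¬path            = no none
      where
      none : ¬ (∃[ k ] RootPath parent v k × k ℕ.≤ suc h)
      none (_ , root eq′ , _) with () ← trans (sym eq) eq′
      none (_ , child eq′ path , s≤s k≤h) with refl ← just-injective (trans (sym eq) eq′) =
        ¬path (_ , path , k≤h)

    ancestor? : ∀ {v k} → RootPath parent v k → ∀ u → Dec (Ancestor parent u v)
    ancestor? (root eq) u = no λ
      { (here eq′)    → nothing≢just eq eq′
      ; (there eq′ _) → nothing≢just eq eq′
      }
      where
      nothing≢just : ∀ {x : Maybe (Fin n)} {y} → x ≡ nothing → x ≡ just y → ⊥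
      nothing≢just refl ()
    ancestor? (child {u = w} eq path) u =
      map′ to from ((w Fin.≟ u) ⊎-dec ancestor? path u)
      where
      to : w ≡ u ⊎ Ancestor parent u w → Ancestor parent u _
      to (inj₁ refl) = here eq
      to (inj₂ anc)  = there eq anc
      from : Ancestor parent u _ → w ≡ u ⊎ Ancestor parent u w
      from (here eq′)      = inj₁ (just-injective (trans (sym eq) eq′))
      from (there eq′ anc) =
        inj₂ (subst (Ancestor parent u) (sym (just-injective (trans (sym eq) eq′))) anc)

  anyMaybe? : ∀ {n} {P : Pred (Maybe (Fin n)) 0ℓ} → Decidable P → Dec (∃ P)
  anyMaybe? P? = map′
    (λ { (inj₁ p) → nothing , p ; (inj₂ (x , p)) → just x , p })
    (λ { (nothing , p) → inj₁ p ; (just x , p) → inj₂ (x , p) })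
    (P? nothing ⊎-dec Fin.any? (P? ∘ just))

  anyVec? : ∀ {n} k {P : Pred (Vec (Maybe (Fin n)) k) 0ℓ} → Decidable P → Dec (∃ P)
  anyVec? zero    P? = map′ ([] ,_) (λ { ([] , p) → p }) (P? [])
  anyVec? (suc k) P? = map′
    (λ (x , xs , p) → x ∷ xs , p)
    (λ { (x ∷ xs , p) → x , xs , p })
    (anyMaybe? λ x → anyVec? k λ xs → P? (x ∷ xs))

  depth≤height : ∀ {n} (F : RootedForest n) v → RootedForest.depth F v ℕ.≤ height F
  depth≤height F v = All.lookup (xs≤max 0 (map (RootedForest.depth F) (allFin _))) (∈-map⁺ (RootedForest.depth F) (∈-allFin v))

  height≤ : ∀ {n} (F : RootedForest n) {h} → (∀ v → RootedForest.depth F v ℕ.≤ h) → height F ℕ.≤ h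
  height≤ F depth≤h = max≤v⁺ {xs = map (RootedForest.depth F) (allFin _)} z≤n (All.map⁺ (All.tabulate λ {v} _ → depth≤h v))

  hasHeight≤? : ∀ {n} (G : Graph n) → Decidable (HasHeight≤ G)
  hasHeight≤? {n} G h = map′
    (λ (parent , paths , sub) →
      let F = record { parent = parent ; rooted = λ v → let k , path , _ = paths v in k , path }
      in F , sub , height≤ F λ v → proj₂ (proj₂ (paths v)))
    (λ (F , sub , F≤h) → RootedForest.parent F ,
      (λ v → _ , proj₂ (RootedForest.rooted F v) , ℕ.≤-trans (depth≤height F v) F≤h) , sub)
    (anyVec? n good?)
    where
    Good : ParentMap n → Set
    Good parent = (∀ v → ∃[ k ] RootPath parent v k × k ℕ.≤ h)
                × (∀ u v → Adj G u v → Ancestor parent u v ⊎ Ancestor parent v u)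
    good? : Decidable Good
    good? parent with Fin.all? (rootPath? parent h)
    ... | no ¬paths = no (¬paths ∘ proj₁)
    ... | yes paths = map′ (paths ,_) proj₂
      (Fin.all? λ u → Fin.all? λ v → adj? G u v →-dec
        (ancestor? parent (path v) u ⊎-dec ancestor? parent (path u) v))
      where
      path : ∀ v → RootPath parent v (proj₁ (paths v))
      path v = proj₁ (proj₂ (paths v))

  pathParent : ∀ {n} → Fin n → Maybe (Fin n)
  pathParent zero    = nothing
  pathParent (suc i) = just (inject₁ i)

  pathMap : ∀ n → ParentMap n
  pathMap n = tabulate pathParent

  pathRooted : ∀ {n} (v : Fin n) → RootPath (pathMap n) v (suc (toℕ v))
  pathRooted {suc n} = Fin.<-weakInduction _ (root refl) λ i path →
    child (lookup∘tabulate pathParent (suc i))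
          (subst (RootPath _ (inject₁ i)) (cong suc (Fin.toℕ-inject₁ i)) path)

  pathAncestor : ∀ {n} (u v : Fin n) → u Fin.< v → Ancestor (pathMap n) u v
  pathAncestor {suc n} u = Fin.<-weakInduction _ (λ ()) step
    where
    step : ∀ i → (u Fin.< inject₁ i → Ancestor _ u (inject₁ i)) → u Fin.< suc i → Ancestor _ u (suc i)
    step i rec (s≤s u≤i) with u Fin.≟ inject₁ i
    ... | yes refl = here (lookup∘tabulate pathParent (suc i))
    ... | no  u≢i  = there (lookup∘tabulate pathParent (suc i)) (rec (ℕ.≤∧≢⇒<
      (subst (toℕ u ℕ.≤_) (sym (Fin.toℕ-inject₁ i)) u≤i) (u≢i ∘ Fin.toℕ-injective)))

  pathForest : ∀ n → RootedForest n
  pathForest n = record { parent = pathMap n ; rooted = λ v → _ , pathRooted v }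

  adj-irrefl : ∀ {n} (G : Graph n) v → ¬ Adj G v v
  adj-irrefl (G ▷ A) (suc v) = adj-irrefl G v

  hasHeight≤n : ∀ {n} (G : Graph n) → HasHeight≤ G n
  hasHeight≤n {n} G = pathForest n , sub , height≤ (pathForest n) Fin.toℕ<n
    where
    sub : G ⊑closure pathForest n
    sub u v uv with ℕ.<-cmp (toℕ u) (toℕ v)
    ... | tri< u<v _ _ = inj₁ (pathAncestor u v u<v)
    ... | tri≈ _ u≡v _ with refl ← Fin.toℕ-injective u≡v = ⊥-elim (adj-irrefl G u uv)
    ... | tri> _ _ v<u = inj₂ (pathAncestor v u v<u)

  least : ∀ {P : Pred ℕ 0ℓ} → Decidable P → ∀ n → P n → ∃[ d ] P d × (∀ k → P k → d ℕ.≤ k)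
  least P? n pn with P? 0
  least P? n       pn | yes p0 = 0 , p0 , λ _ _ → z≤n
  least P? zero    pn | no ¬p0 = ⊥-elim (¬p0 pn)
  least P? (suc n) pn | no ¬p0 with least (P? ∘ suc) n pn
  ... | d , pd , d≤ = suc d , pd , λ { zero p0 → ⊥-elim (¬p0 p0) ; (suc k) pk → s≤s (d≤ k pk) }

treeDepth : ∀ {n} (G : Graph n) → ∃ (IsTreeDepth G)
treeDepth {n} G with least (hasHeight≤? G) n (hasHeight≤n G)
... | d , (F , sub , F≤d) , d≤ = d , (F , sub , ℕ.≤-antisym F≤d (minimal F sub)) , minimal
  where
  minimal : ∀ F → G ⊑closure F → d ℕ.≤ height F
  minimal F sub = d≤ (height F) (F , sub , ℕ.≤-refl)

td : ∀ {n} → Graph n → ℕ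
td G = proj₁ (treeDepth G)

td-isTreeDepth : ∀ {n} (G : Graph n) → IsTreeDepth G (td G)
td-isTreeDepth G = proj₂ (treeDepth G)

------------------------------------------------------------------------
-- The Erdős–Rényi random graph

allSubsets : ∀ n → List (Subset n)
allSubsets zero    = [ [] ]
allSubsets (suc n) = cartesianProductWith _∷_ (inside ∷ outside ∷ []) (allSubsets n)

allGraphs : ∀ n → List (Graph n)
allGraphs zero    = [ ∅ ]
allGraphs (suc n) = cartesianProductWith _▷_ (allGraphs n) (allSubsets n)

module ErdősRényi (ℝ : CompleteOrderedField) where
  open CompleteOrderedField ℝ public

  -- The probability of a single graph: a factor p for every edge and 1 - p
  -- for every non-edge.

  subsetWeight : Carrier → ∀ {n} → Subset n → Carrier
  subsetWeight p []            = 1#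
  subsetWeight p (inside  ∷ A) = p * subsetWeight p A
  subsetWeight p (outside ∷ A) = (1# - p) * subsetWeight p A

  weight : Carrier → ∀ {n} → Graph n → Carrier
  weight p ∅       = 1#
  weight p (G ▷ A) = weight p G * subsetWeight p A

  Pr : ∀ {n} → Carrier → {E : Pred (Graph n) 0ℓ} → Decidable E → Carrier
  Pr {n} p E? = foldr _+_ 0# (map (weight p) (filter E? (allGraphs n)))

{-# OPTIONS --safe #-}
module Submission where

-- Suppose that td(G) ≤ n - 3m, and take an optimal forest.  Call a vertex heavy
-- if its subtree has at least m vertices.  Either two heavy vertices are
-- incomparable, or the heavy vertices form a chain and at least 3m vertices lie
-- in pairwise incomparable subtrees of size less than m, which can be grouped
-- greedily.  In both cases there are disjoint sets A, B of size at least m without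
-- edges between them.  A given such pair exists with probability at most
-- (1 - p)^(m²), and there are at most 4ⁿ pairs.  Choosing m of order
-- √(n/p) with m²p ≥ 9n makes (1 - p)^(m²) at most 8⁻ⁿ.

open import Defs
open import Algebra.Bundles using (CommutativeRing)
import Algebra.Properties.Monoid.Mult as Mult
import Algebra.Properties.Semiring.Exp as Exp
import Algebra.Properties.Semiring.Mult as SemiringMult
import Algebra.Solver.Ring.NaturalCoefficients.Default as SemiringSolver
open import Data.Fin.Base using (Fin; zero; suc; toℕ)
open import Data.Fin.Properties using (toℕ<n; toℕ-injective; any?; all?)
open import Data.Fin.Subset using (Subset; Side; inside; outside; _∈_; _∪_; _⊆_; ∣_∣; ∁; ⁅_⁆)
open import Data.Fin.Subset.Properties
  using ( _∈?_; ∣p∣≤n; ∣⊥∣≡0; ∣⁅x⁆∣≡1; Empty-unique; p⊆q⇒∣p∣≤∣q∣; p⊂q⇒∣p∣<∣q∣; ∣∁p∣≡n∸∣p∣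
        ; x∈∁p⇒x∉p; x∈p∪q⁺; x∈p∪q⁻; q⊆p∪q; x∈⁅x⁆; x∈⁅y⁆⇒x≡y )
open import Data.List.Base
  using (List; []; _∷_; _++_; map; foldr; filter; length; allFin; cartesianProduct; cartesianProductWith)
open import Data.List.Extrema.Nat using (xs≤max; max≤v⁺)
open import Data.List.Membership.Propositional using () renaming (_∈_ to _∈ₗ_)
open import Data.List.Membership.Propositional.Properties
  using (∈-map⁺; ∈-allFin; ∈-filter⁺; ∈-cartesianProductWith⁺; ∈-cartesianProduct⁺)
open import Data.List.Properties using (length-filter; length-++; length-map)
open import Data.List.Relation.Unary.All as All using (All; []; _∷_)
open import Data.List.Relation.Unary.All.Properties using (map⁺; all-filter)
open import Data.List.Relation.Unary.Any using (here; there)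
open import Data.Maybe.Base using (just)
open import Data.Maybe.Properties using (just-injective)
open import Data.Nat.Base as ℕ using (ℕ; zero; suc; z≤n; s≤s)
open import Data.Nat.DivMod using (m≡m%n+[m/n]*n; m%n<n; m/n*n≤m)
import Data.Nat.Properties as ℕ
open import Data.Nat.Solver using (module +-*-Solver)
open import Data.Product.Base using (∃₂; ∃-syntax; _×_; _,_; proj₁; proj₂)
open import Data.Sum.Base using (_⊎_; inj₁; inj₂)
open import Data.Vec.Base using ([]; _∷_; here; there; lookup; tabulate)
open import Data.Vec.Properties using (lookup∘tabulate; lookup⇒[]=; []=⇒lookup)
open import Function.Base using (_∘_; flip)
open import Level using (0ℓ)
open import Relation.Binary.Bundles using (DecTotalOrder)
open import Relation.Binary.Core using (Rel)
import Relation.Binary.Definitions as Binary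
import Relation.Binary.Properties.DecTotalOrder as DecTotalOrderProperties
open import Relation.Binary.PropositionalEquality.Core using (_≡_; refl; sym; trans; cong; cong₂; subst)
import Relation.Binary.Reasoning.PartialOrder as ≤-Reasoning
open import Relation.Nullary.Decidable
  using (Dec; yes; no; does; map′; ¬?; _×-dec_; _⊎-dec_; _→-dec_; dec-true; decidable-stable)
open import Relation.Nullary.Negation using (¬_; contradiction)
open import Relation.Unary using (Pred; Decidable)

-- The forest enters only through its ancestor order, a preorder in which the vertices below a given
-- one (towards the root) are pairwise comparable. The margin 3m is spent as follows: a chain of
-- heavy vertices lies on a single root path, so it has at most td(G) vertices; a greedy group that
-- has just reached m vertices stays within 2m; and m vertices must be left for the other side.
--
-- Probabilities are finite sums over lists, so independence has to be visible in the recursion that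
-- builds a graph. The indicator of an edgeless pair is therefore a product with one factor per
-- added vertex, just like the weight, and its expectation splits vertex by vertex.
--
-- In place of exponentials stands the inequality (1 - p)^k (1 + kp) ≤ 1, raised to the n-th power
-- with k = m²/n rounded down. The resulting failure probability is at most 1/n, and this tends to 0
-- because n ≥ np.

private variable
  n : ℕ

-- Subsets of `Fin n` and finite searches

comprehension : {P : Pred (Fin n) 0ℓ} → Decidable P → Subset n
comprehension P? = tabulate (does ∘ P?)

module _ {P : Pred (Fin n) 0ℓ} (P? : Decidable P) where

  ∈-comprehension⁺ : ∀ {x} → P x → x ∈ comprehension P?
  ∈-comprehension⁺ {x} px =
    lookup⇒[]= x _ (trans (lookup∘tabulate (does ∘ P?) x) (dec-true (P? x) px))

  ∈-comprehension⁻ : ∀ {x} → x ∈ comprehension P? → P x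
  ∈-comprehension⁻ {x} x∈ with P? x | trans (sym (lookup∘tabulate (does ∘ P?) x)) ([]=⇒lookup x∈)
  ... | yes px | _ = px

∣p∪q∣≤∣p∣+∣q∣ : ∀ (p q : Subset n) → ∣ p ∪ q ∣ ℕ.≤ ∣ p ∣ ℕ.+ ∣ q ∣
∣p∪q∣≤∣p∣+∣q∣ []            []            = z≤n
∣p∪q∣≤∣p∣+∣q∣ (outside ∷ p) (outside ∷ q) = ∣p∪q∣≤∣p∣+∣q∣ p q
∣p∪q∣≤∣p∣+∣q∣ (outside ∷ p) (inside  ∷ q) =
  ℕ.≤-trans (s≤s (∣p∪q∣≤∣p∣+∣q∣ p q)) (ℕ.≤-reflexive (sym (ℕ.+-suc ∣ p ∣ ∣ q ∣)))
∣p∪q∣≤∣p∣+∣q∣ (inside  ∷ p) (outside ∷ q) = s≤s (∣p∪q∣≤∣p∣+∣q∣ p q)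
∣p∪q∣≤∣p∣+∣q∣ (inside  ∷ p) (inside  ∷ q) =
  s≤s (ℕ.≤-trans (∣p∪q∣≤∣p∣+∣q∣ p q) (ℕ.+-monoʳ-≤ ∣ p ∣ (ℕ.n≤1+n ∣ q ∣)))

∣empty∣≤ : ∀ {p : Subset n} {k} → (∀ {x} → ¬ x ∈ p) → ∣ p ∣ ℕ.≤ k
∣empty∣≤ {n} x∉p with refl ← Empty-unique (λ (_ , x∈p) → x∉p x∈p) = ℕ.≤-trans (ℕ.≤-reflexive (∣⊥∣≡0 n)) z≤n

-- Walking down from `n`, the first failure met sits just below a success. It serves the greedy
-- grouping and the rounding of √(n/p).
crossing : {P : Pred ℕ 0ℓ} → Decidable P → ¬ P 0 → ∀ n → P n → ∃[ j ] ¬ P j × P (suc j)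
crossing P? ¬p0 zero    p0 = contradiction p0 ¬p0
crossing P? ¬p0 (suc n) pn with P? n
... | yes p  = crossing P? ¬p0 n p
... | no  ¬p = n , ¬p , pn

-- A maximum for a preorder that is total on `P`. It is applied to the ancestor order, for the
-- deepest heavy vertex, and to its reverse, for the light ancestor nearest the root.
greatest : {A : Set} {P : Pred A 0ℓ} {_⊴_ : Rel A 0ℓ} → Decidable P → Binary.Transitive _⊴_ →
           (∀ {x y} → P x → P y → x ⊴ y ⊎ y ⊴ x) →
           ∀ xs → All (¬_ ∘ P) xs ⊎ ∃[ t ] P t × All (λ x → P x → x ⊴ t) xs
greatest {P = P} {_⊴_} P? ⊴-trans total = go
  where
  self : ∀ {x} → P x → x ⊴ x
  self px with total px px
  ... | inj₁ x⊴x = x⊴x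
  ... | inj₂ x⊴x = x⊴x
  go : ∀ xs → All (¬_ ∘ P) xs ⊎ ∃[ t ] P t × All (λ x → P x → x ⊴ t) xs
  go []       = inj₁ []
  go (x ∷ xs) with P? x | go xs
  ... | no ¬px | inj₁ none         = inj₁ (¬px ∷ none)
  ... | no ¬px | inj₂ (t , pt , ≤t) = inj₂ (t , pt , flip contradiction ¬px ∷ ≤t)
  ... | yes px | inj₁ none         = inj₂ (x , px , self ∷ All.map (λ ¬py py → contradiction py ¬py) none)
  ... | yes px | inj₂ (t , pt , ≤t) with total px pt
  ...   | inj₁ x⊴t = inj₂ (t , pt , (λ _ → x⊴t) ∷ ≤t)
  ...   | inj₂ t⊴x = inj₂ (x , px , self ∷ All.map (λ y⊴t py → ⊴-trans (y⊴t py) t⊴x) ≤t)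

-- Separated sets in an abstract forest order

module _ {n} {_≼_ : Rel (Fin n) 0ℓ} (_≼?_ : Binary.Decidable _≼_)
         (≼-refl : Binary.Reflexive _≼_) (≼-trans : Binary.Transitive _≼_)
         (chain : ∀ {u v w} → u ≼ w → v ≼ w → u ≼ v ⊎ v ≼ u) where

  ↓_ ↑_ : Fin n → Subset n
  ↓ v = comprehension (_≼? v)
  ↑ u = comprehension (u ≼?_)

  Separated : Subset n → Subset n → Set
  Separated A B = ∀ {u v} → u ∈ A → v ∈ B → ¬ u ≼ v × ¬ v ≼ u

  -- `h` stands for the height: it bounds every chain, since a chain lies in the down-set of its
  -- greatest element. `0 < m` makes the greedy grouping start below its target.
  separation : ∀ {h m} → 0 ℕ.< m → (∀ v → ∣ ↓ v ∣ ℕ.≤ h) → h ℕ.+ 3 ℕ.* m ℕ.≤ n →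
               ∃₂ λ A B → Separated A B × m ℕ.≤ ∣ A ∣ × m ℕ.≤ ∣ B ∣
  separation {h} {m} 0<m ∣↓∣≤h h+3m≤n with any? (λ u → any? (λ v →
      ((m ℕ.≤? ∣ ↑ u ∣) ×-dec (m ℕ.≤? ∣ ↑ v ∣)) ×-dec (¬? (u ≼? v) ×-dec ¬? (v ≼? u))))
  ... | yes (u , v , (m≤↑u , m≤↑v) , u⋠v , v⋠u) = ↑ u , ↑ v , apart , m≤↑u , m≤↑v
    where
    -- A comparability across the two subtrees puts `u` and `v` below one common vertex, where
    -- `chain` makes them comparable.
    apart : Separated (↑ u) (↑ v)
    apart x∈↑u y∈↑v = (λ x≼y → incomparable (chain (≼-trans u≼x x≼y) v≼y))
                    , (λ y≼x → incomparable (chain u≼x (≼-trans v≼y y≼x)))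
      where
      u≼x = ∈-comprehension⁻ (u ≼?_) x∈↑u
      v≼y = ∈-comprehension⁻ (v ≼?_) y∈↑v
      incomparable : ¬ (u ≼ v ⊎ v ≼ u)
      incomparable (inj₁ u≼v) = u⋠v u≼v
      incomparable (inj₂ v≼u) = v⋠u v≼u
  ... | no allComparable =
    let j , few , many = crossing (λ j → m ℕ.≤? ∣ C j ∣) C-empty n C-full
    in C (suc j) , rest j , apart j , many , rest-large j few
    where
    Heavy : Pred (Fin n) 0ℓ
    Heavy v = m ℕ.≤ ∣ ↑ v ∣

    heavy? : Decidable Heavy
    heavy? v = m ℕ.≤? ∣ ↑ v ∣

    comparable : ∀ {u v} → Heavy u → Heavy v → u ≼ v ⊎ v ≼ u
    comparable {u} {v} hu hv = decidable-stable ((u ≼? v) ⊎-dec (v ≼? u)) λ ¬comparable →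
      allComparable (u , v , (hu , hv) , ¬comparable ∘ inj₁ , ¬comparable ∘ inj₂)

    H : Subset n
    H = comprehension heavy?

    -- In this case the heavy vertices form a chain, so all of them lie in the down-set of the
    -- deepest one.
    ∣H∣≤h : ∣ H ∣ ℕ.≤ h
    ∣H∣≤h with greatest heavy? ≼-trans comparable (allFin n)
    ... | inj₁ none = ∣empty∣≤ λ x∈H → All.lookup none (∈-allFin _) (∈-comprehension⁻ heavy? x∈H)
    ... | inj₂ (t , _ , ≼t) = ℕ.≤-trans
      (p⊆q⇒∣p∣≤∣q∣ λ x∈H → ∈-comprehension⁺ (_≼? t)
        (All.lookup ≼t (∈-allFin _) (∈-comprehension⁻ heavy? x∈H)))
      (∣↓∣≤h t)

    -- The subtrees of the top vertices partition the light vertices.  C j collects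
    -- those whose root has label below j, so each step adds at most one subtree.

    Top : Pred (Fin n) 0ℓ
    Top u = ¬ Heavy u × (∀ w → w ≼ u → ¬ Heavy w → u ≼ w)

    top? : Decidable Top
    top? u = ¬? (heavy? u) ×-dec all? (λ w → (w ≼? u) →-dec (¬? (heavy? w) →-dec (u ≼? w)))

    -- By `chain` the light vertices below `v` form a chain; its element nearest the root, found as
    -- the greatest one of the reversed order, is a top vertex.
    topAbove : ∀ {v} → ¬ Heavy v → ∃[ u ] Top u × u ≼ v
    topAbove {v} ¬hv with greatest {P = λ w → w ≼ v × ¬ Heavy w} {_⊴_ = flip _≼_}
      (λ w → (w ≼? v) ×-dec ¬? (heavy? w)) (flip ≼-trans)
      (λ (x≼v , _) (y≼v , _) → chain y≼v x≼v) (allFin n)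
    ... | inj₁ none = contradiction (≼-refl , ¬hv) (All.lookup none (∈-allFin v))
    ... | inj₂ (u , (u≼v , ¬hu) , u≼) = u ,
      (¬hu , λ w w≼u ¬hw → All.lookup u≼ (∈-allFin w) (≼-trans w≼u u≼v , ¬hw)) , u≼v

    Covered : ℕ → Pred (Fin n) 0ℓ
    Covered j v = ∃[ u ] (toℕ u ℕ.< j × Top u) × u ≼ v

    covered? : ∀ j → Decidable (Covered j)
    covered? j v = any? λ u → ((toℕ u ℕ.<? j) ×-dec top? u) ×-dec (u ≼? v)

    C : ℕ → Subset n
    C j = comprehension (covered? j)

    C-empty : ¬ m ℕ.≤ ∣ C 0 ∣
    C-empty m≤∣C0∣ = ℕ.<⇒≱ 0<m (ℕ.≤-trans m≤∣C0∣
      (∣empty∣≤ λ x∈C0 → uncovered (∈-comprehension⁻ (covered? 0) x∈C0)))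
      where
      uncovered : ∀ {v} → ¬ Covered 0 v
      uncovered (_ , (() , _) , _)

    C-step : ∀ j → ∣ C (suc j) ∣ ℕ.≤ ∣ C j ∣ ℕ.+ m
    C-step j with any? (λ u → (toℕ u ℕ.≟ j) ×-dec top? u)
    ... | yes (u , u≡j , ¬hu , _) = begin
      ∣ C (suc j) ∣        ≤⟨ p⊆q⇒∣p∣≤∣q∣ C⊆ ⟩
      ∣ C j ∪ ↑ u ∣        ≤⟨ ∣p∪q∣≤∣p∣+∣q∣ (C j) (↑ u) ⟩
      ∣ C j ∣ ℕ.+ ∣ ↑ u ∣  ≤⟨ ℕ.+-monoʳ-≤ ∣ C j ∣ (ℕ.≰⇒≥ ¬hu) ⟩
      ∣ C j ∣ ℕ.+ m        ∎
      where
      open ℕ.≤-Reasoning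
      C⊆ : C (suc j) ⊆ C j ∪ ↑ u
      C⊆ x∈ with ∈-comprehension⁻ (covered? (suc j)) x∈
      ... | v , (v<1+j , tv) , v≼x with ℕ.m<1+n⇒m<n∨m≡n v<1+j
      ...   | inj₁ v<j = x∈p∪q⁺ (inj₁ (∈-comprehension⁺ (covered? j) (v , (v<j , tv) , v≼x)))
      ...   | inj₂ v≡j = x∈p∪q⁺ (inj₂ (∈-comprehension⁺ (u ≼?_)
        (subst (_≼ _) (toℕ-injective (trans v≡j (sym u≡j))) v≼x)))
    ... | no none = ℕ.≤-trans (p⊆q⇒∣p∣≤∣q∣ C⊆) (ℕ.m≤m+n ∣ C j ∣ m)
      where
      C⊆ : C (suc j) ⊆ C j
      C⊆ x∈ with ∈-comprehension⁻ (covered? (suc j)) x∈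
      ... | v , (v<1+j , tv) , v≼x with ℕ.m<1+n⇒m<n∨m≡n v<1+j
      ...   | inj₁ v<j = ∈-comprehension⁺ (covered? j) (v , (v<j , tv) , v≼x)
      ...   | inj₂ v≡j = contradiction (v , v≡j , tv) none

    remainder : ∀ {p q : Subset n} → ∁ p ⊆ q → ∣ p ∣ ℕ.+ m ℕ.≤ n → m ℕ.≤ ∣ q ∣
    remainder {p} {q} ∁p⊆q ∣p∣+m≤n = begin
      m            ≤⟨ ℕ.m+n≤o⇒m≤o∸n m (subst (ℕ._≤ n) (ℕ.+-comm ∣ p ∣ m) ∣p∣+m≤n) ⟩
      n ℕ.∸ ∣ p ∣  ≡⟨ ∣∁p∣≡n∸∣p∣ p ⟨
      ∣ ∁ p ∣      ≤⟨ p⊆q⇒∣p∣≤∣q∣ ∁p⊆q ⟩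
      ∣ q ∣        ∎
      where open ℕ.≤-Reasoning

    -- Every label is below `n`, so `C n` contains all light vertices, and at most `h` vertices are
    -- heavy.
    C-full : m ℕ.≤ ∣ C n ∣
    C-full = remainder {H} ∁H⊆ (ℕ.≤-trans (ℕ.+-mono-≤ ∣H∣≤h (ℕ.m≤m+n m _)) h+3m≤n)
      where
      ∁H⊆ : ∁ H ⊆ C n
      ∁H⊆ x∈ with topAbove (x∈∁p⇒x∉p x∈ ∘ ∈-comprehension⁺ heavy?)
      ... | u , tu , u≼x = ∈-comprehension⁺ (covered? n) (u , (toℕ<n u , tu) , u≼x)

    rest? : ∀ j → Decidable (λ v → ¬ Heavy v × ¬ Covered (suc j) v)
    rest? j v = ¬? (heavy? v) ×-dec ¬? (covered? (suc j) v)

    rest : ℕ → Subset n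
    rest j = comprehension (rest? j)

    apart : ∀ j → Separated (C (suc j)) (rest j)
    apart j v∈C w∈rest =
      incomparable (∈-comprehension⁻ (covered? (suc j)) v∈C) (∈-comprehension⁻ (rest? j) w∈rest)
      where
      incomparable : ∀ {v w} → Covered (suc j) v → ¬ Heavy w × ¬ Covered (suc j) w → ¬ v ≼ w × ¬ w ≼ v
      incomparable {v} {w} (u , (u≤j , u-top) , u≼v) (w-light , uncovered) =
        (λ v≼w → uncovered (u , (u≤j , u-top) , ≼-trans u≼v v≼w)) , w⋠v
        where
        w⋠v : ¬ w ≼ v
        w⋠v w≼v with chain u≼v w≼v
        ... | inj₁ u≼w = uncovered (u , (u≤j , u-top) , u≼w)
        -- Here `w` is a light vertex below the top vertex `u`, so `Top` returns `u ≼ w` and `w` is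
        -- covered after all.
        ... | inj₂ w≼u = uncovered (u , (u≤j , u-top) , proj₂ u-top w w≼u w-light)

    -- One step earlier the group was still smaller than `m`, so `C (suc j)` has at most `2m`
    -- vertices. Together with the heavy ones at most `h + 2m` are used up.
    rest-large : ∀ j → ¬ m ℕ.≤ ∣ C j ∣ → m ℕ.≤ ∣ rest j ∣
    rest-large j few = remainder {H ∪ C (suc j)} ∁⊆ (begin
      ∣ H ∪ C (suc j) ∣ ℕ.+ m          ≤⟨ ℕ.+-monoˡ-≤ m (∣p∪q∣≤∣p∣+∣q∣ H (C (suc j))) ⟩
      ∣ H ∣ ℕ.+ ∣ C (suc j) ∣ ℕ.+ m    ≤⟨ ℕ.+-monoˡ-≤ m (ℕ.+-mono-≤ ∣H∣≤h (C-step j)) ⟩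
      h ℕ.+ (∣ C j ∣ ℕ.+ m) ℕ.+ m      ≤⟨ ℕ.+-monoˡ-≤ m (ℕ.+-monoʳ-≤ h (ℕ.+-monoˡ-≤ m (ℕ.≰⇒≥ few))) ⟩
      h ℕ.+ (m ℕ.+ m) ℕ.+ m            ≡⟨ solve 2 (λ h m → h :+ (m :+ m) :+ m := h :+ con 3 :* m) refl h m ⟩
      h ℕ.+ 3 ℕ.* m                    ≤⟨ h+3m≤n ⟩
      n                                ∎)
      where
      open ℕ.≤-Reasoning
      open +-*-Solver
      ∁⊆ : ∁ (H ∪ C (suc j)) ⊆ rest j
      ∁⊆ x∈ = ∈-comprehension⁺ (rest? j)
        ( (λ heavy → x∈∁p⇒x∉p x∈ (x∈p∪q⁺ (inj₁ (∈-comprehension⁺ heavy? heavy))))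
        , (λ covered → x∈∁p⇒x∉p x∈ (x∈p∪q⁺ (inj₂ (∈-comprehension⁺ (covered? (suc j)) covered)))) )

-- The ancestor order of a rooted forest

module _ {n} (F : RootedForest n) where
  open RootedForest F hiding (height)

  infix 4 _≼_

  _≼_ : Rel (Fin n) 0ℓ
  u ≼ v = u ≡ v ⊎ Ancestor parent u v

  parent-unique : ∀ {v u w} → lookup parent v ≡ just u → lookup parent v ≡ just w → u ≡ w
  parent-unique pu pw = just-injective (trans (sym pu) pw)

  Ancestor-trans : ∀ {u v w} → Ancestor parent u v → Ancestor parent v w → Ancestor parent u w
  Ancestor-trans uv (here pw)     = there pw uv
  Ancestor-trans uv (there pw vx) = there pw (Ancestor-trans uv vx)

  ≼-trans : Binary.Transitive _≼_
  ≼-trans (inj₁ refl) v≼w         = v≼w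
  ≼-trans (inj₂ uv)   (inj₁ refl) = inj₂ uv
  ≼-trans (inj₂ uv)   (inj₂ vw)   = inj₂ (Ancestor-trans uv vw)

  Ancestor-parent : ∀ {u v w} → lookup parent w ≡ just v → Ancestor parent u w → u ≼ v
  Ancestor-parent pw (here pw′)     = inj₁ (parent-unique pw′ pw)
  Ancestor-parent pw (there pw′ ux) = inj₂ (subst (Ancestor parent _) (parent-unique pw′ pw) ux)

  -- Parents are unique, so both ancestries climb from `w` along the same path; whichever stops
  -- first belongs to the descendant.
  Ancestor-chain : ∀ {u v w} → Ancestor parent u w → v ≼ w → u ≼ v ⊎ v ≼ u
  Ancestor-chain uw            (inj₁ refl)          = inj₁ (inj₂ uw)
  Ancestor-chain uw            (inj₂ (here pw))     = inj₁ (Ancestor-parent pw uw)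
  Ancestor-chain (here pw)     (inj₂ (there pw′ vx)) = inj₂ (inj₂ (subst (Ancestor parent _) (parent-unique pw′ pw) vx))
  Ancestor-chain (there pw ux) (inj₂ (there pw′ vy)) with refl ← parent-unique pw pw′ = Ancestor-chain ux (inj₂ vy)

  ≼-chain : ∀ {u v w} → u ≼ w → v ≼ w → u ≼ v ⊎ v ≼ u
  ≼-chain (inj₁ refl) v≼w = inj₂ v≼w
  ≼-chain (inj₂ uw)   v≼w = Ancestor-chain uw v≼w

  -- The down-set of `v`, computed from its root path. This makes `_≼_` decidable and ties the size
  -- of a down-set to the depth.
  pathVertices : ∀ {v k} → RootPath parent v k → Subset n
  pathVertices (root {v} _)    = ⁅ v ⁆
  pathVertices (child {v} _ path) = ⁅ v ⁆ ∪ pathVertices path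

  ∈-pathVertices⁺ : ∀ {u v k} (path : RootPath parent v k) → u ≼ v → u ∈ pathVertices path
  ∈-pathVertices⁺ (root _)        (inj₁ refl) = x∈⁅x⁆ _
  ∈-pathVertices⁺ (root ¬p)       (inj₂ (here p)) with () ← trans (sym ¬p) p
  ∈-pathVertices⁺ (root ¬p)       (inj₂ (there p _)) with () ← trans (sym ¬p) p
  ∈-pathVertices⁺ (child _ path)  (inj₁ refl) = x∈p∪q⁺ (inj₁ (x∈⁅x⁆ _))
  ∈-pathVertices⁺ (child p path)  (inj₂ uv)   = x∈p∪q⁺ (inj₂ (∈-pathVertices⁺ path (Ancestor-parent p uv)))

  ∈-pathVertices⁻ : ∀ {u v k} (path : RootPath parent v k) → u ∈ pathVertices path → u ≼ v
  ∈-pathVertices⁻ (root _)       u∈ = inj₁ (x∈⁅y⁆⇒x≡y _ u∈)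
  ∈-pathVertices⁻ (child {v} p path) u∈ with x∈p∪q⁻ ⁅ v ⁆ (pathVertices path) u∈
  ... | inj₁ u∈⁅v⁆ = inj₁ (x∈⁅y⁆⇒x≡y _ u∈⁅v⁆)
  ... | inj₂ u∈path = ≼-trans (∈-pathVertices⁻ path u∈path) (inj₂ (here p))

  ∣pathVertices∣≤ : ∀ {v k} (path : RootPath parent v k) → ∣ pathVertices path ∣ ℕ.≤ k
  ∣pathVertices∣≤ (root {v} _)       = ℕ.≤-reflexive (∣⁅x⁆∣≡1 v)
  ∣pathVertices∣≤ (child {v} p path) = ℕ.≤-trans (∣p∪q∣≤∣p∣+∣q∣ ⁅ v ⁆ (pathVertices path))
    (ℕ.+-mono-≤ (ℕ.≤-reflexive (∣⁅x⁆∣≡1 v)) (∣pathVertices∣≤ path))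

  -- A cycle through `v` yields one through its parent, and so on along the finite root path until
  -- it would pass through a root.
  acyclic : ∀ {v k} → RootPath parent v k → ¬ Ancestor parent v v
  acyclic (root ¬p)      (here p) with () ← trans (sym ¬p) p
  acyclic (root ¬p)      (there p _) with () ← trans (sym ¬p) p
  acyclic (child p path) vv with Ancestor-parent p vv
  ... | inj₁ refl = acyclic path (here p)
  ... | inj₂ vu   = acyclic path (Ancestor-trans (here p) vu)

  -- By `acyclic` the child does not recur further up, so each step of the path adds a new element.
  -- This is what gives `td G ≤ n`.
  ≤∣pathVertices∣ : ∀ {v k} (path : RootPath parent v k) → k ℕ.≤ ∣ pathVertices path ∣
  ≤∣pathVertices∣ (root {v} _) = ℕ.≤-reflexive (sym (∣⁅x⁆∣≡1 v))
  ≤∣pathVertices∣ (child {v} p path) = ℕ.≤-<-trans (≤∣pathVertices∣ path) (p⊂q⇒∣p∣<∣q∣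
    ( q⊆p∪q ⁅ v ⁆ (pathVertices path) , v , x∈p∪q⁺ (inj₁ (x∈⁅x⁆ v))
    , λ v∈path → acyclic (child p path) (properAncestor (∈-pathVertices⁻ path v∈path))))
    where
    properAncestor : v ≼ _ → Ancestor parent v v
    properAncestor (inj₁ refl) = here p
    properAncestor (inj₂ vu)   = there p vu

  _≼?_ : Binary.Decidable _≼_
  u ≼? v = map′ (∈-pathVertices⁻ path) (∈-pathVertices⁺ path) (u ∈? pathVertices path)
    where path = proj₂ (rooted v)

  depth≤height : ∀ v → depth v ℕ.≤ height F
  depth≤height v = All.lookup (xs≤max 0 (map depth (allFin _))) (∈-map⁺ depth (∈-allFin v))

  ∣↓∣≤height : ∀ v → ∣ comprehension (_≼? v) ∣ ℕ.≤ height F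
  ∣↓∣≤height v = ℕ.≤-trans
    (p⊆q⇒∣p∣≤∣q∣ λ u∈ → ∈-pathVertices⁺ (proj₂ (rooted v)) (∈-comprehension⁻ (_≼? v) u∈))
    (ℕ.≤-trans (∣pathVertices∣≤ (proj₂ (rooted v))) (depth≤height v))

  height≤n : height F ℕ.≤ n
  height≤n = max≤v⁺ {xs = map depth (allFin _)} z≤n (map⁺ (All.tabulate λ {v} _ →
    ℕ.≤-trans (≤∣pathVertices∣ (proj₂ (rooted v))) (∣p∣≤n (pathVertices (proj₂ (rooted v))))))

td≤n : ∀ (G : Graph n) → td G ℕ.≤ n
td≤n G with (F , _ , height≡td) , _ ← td-isTreeDepth G = subst (ℕ._≤ _) height≡td (height≤n F)

-- Edgeless pairs from small tree-depth

NoEdges : Graph n → Subset n → Subset n → Set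
NoEdges G A B = ∀ {u v} → u ∈ A → v ∈ B → ¬ Adj G u v

Disjoint : Subset n → Subset n → Set
Disjoint A B = ∀ x → x ∈ A → ¬ x ∈ B

-- Adjacent vertices are comparable in the forest, so separated sets span no edge. A common vertex
-- would be comparable with itself, hence the sets are disjoint, which the exact probability of an
-- edgeless pair relies on.
td-separation : ∀ (G : Graph n) {m} → 0 ℕ.< m → td G ℕ.+ 3 ℕ.* m ℕ.≤ n →
  ∃₂ λ A B → NoEdges G A B × Disjoint A B × m ℕ.≤ ∣ A ∣ × m ℕ.≤ ∣ B ∣
td-separation {n} G {m} 0<m td+3m≤n = fromForest (proj₁ (td-isTreeDepth G))
  where
  fromForest : (∃[ F ] G ⊑closure F × height F ≡ td G) →
    ∃₂ λ A B → NoEdges G A B × Disjoint A B × m ℕ.≤ ∣ A ∣ × m ℕ.≤ ∣ B ∣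
  fromForest (F , G⊑F , height≡td) =
    let A , B , apart , m≤A , m≤B = separation (_≼?_ F) (inj₁ refl) (≼-trans F) (≼-chain F) 0<m
          (λ v → ℕ.≤-trans (∣↓∣≤height F v) (ℕ.≤-reflexive height≡td)) td+3m≤n
    in A , B
     , (λ u∈A v∈B uv → separated⇒nonadjacent (apart u∈A v∈B) (G⊑F _ _ uv))
     , (λ x x∈A x∈B → proj₁ (apart {x} {x} x∈A x∈B) (inj₁ refl))
     , m≤A , m≤B
    where
    separated⇒nonadjacent : ∀ {u v} → ¬ _≼_ F u v × ¬ _≼_ F v u → ¬ ClosureAdj F u v
    separated⇒nonadjacent (u⋠v , _) (inj₁ uv) = u⋠v (inj₂ uv)
    separated⇒nonadjacent (_ , v⋠u) (inj₂ vu) = v⋠u (inj₂ vu)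

n≤2^n : ∀ n → n ℕ.≤ 2 ℕ.^ n
n≤2^n zero    = z≤n
n≤2^n (suc n) = begin
  1 ℕ.+ n                  ≤⟨ ℕ.+-mono-≤ (ℕ.m^n>0 2 n) (n≤2^n n) ⟩
  2 ℕ.^ n ℕ.+ 2 ℕ.^ n      ≡⟨ cong (2 ℕ.^ n ℕ.+_) (ℕ.+-identityʳ (2 ℕ.^ n)) ⟨
  2 ℕ.* 2 ℕ.^ n            ∎
  where open ℕ.≤-Reasoning

2ⁿ*2ⁿ*2ⁿ≡8ⁿ : ∀ n → 2 ℕ.^ n ℕ.* 2 ℕ.^ n ℕ.* 2 ℕ.^ n ≡ 8 ℕ.^ n
2ⁿ*2ⁿ*2ⁿ≡8ⁿ zero    = refl
2ⁿ*2ⁿ*2ⁿ≡8ⁿ (suc n) = trans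
  (solve 1 (λ a → con 2 :* a :* (con 2 :* a) :* (con 2 :* a) := con 8 :* (a :* a :* a)) refl (2 ℕ.^ n))
  (cong (8 ℕ.*_) (2ⁿ*2ⁿ*2ⁿ≡8ⁿ n))
  where open +-*-Solver

module EdgeProbability (ℝ : CompleteOrderedField) where
  open ErdősRényi ℝ
  open CommutativeRing commutativeRing using
    ( +-cong; +-congˡ; +-congʳ; +-assoc; +-comm; +-identityˡ; +-identityʳ; -‿inverseʳ; -‿inverseˡ
    ; *-cong; *-congˡ; *-congʳ; *-assoc; *-comm; *-identityˡ; *-identityʳ
    ; zeroˡ; zeroʳ; distribˡ; distribʳ; semiring; commutativeSemiring; +-monoid)
    renaming (refl to ≈-refl; sym to ≈-sym; trans to ≈-trans; reflexive to ≈-reflexive)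
  open DecTotalOrder decTotalOrder using (poset; ≤-respˡ-≈; ≤-respʳ-≈)
    renaming (refl to ≤-refl; trans to ≤-trans; reflexive to ≤-reflexive; antisym to ≤-antisym; total to ≤-total)
  open DecTotalOrderProperties decTotalOrder using (≰⇒>; ≰⇒≥)
  open Exp semiring using (_^_; ^-homo-*; ^-assocʳ)
  open ≤-Reasoning poset
  open SemiringSolver commutativeSemiring using (solve; _:=_; _:+_; _:*_)

  -- Arithmetic in the ordered field

  +-mono-≤ : ∀ {w x y z} → w ≤ x → y ≤ z → w + y ≤ x + z
  +-mono-≤ {w} {x} {y} {z} w≤x y≤z = begin
    w + y  ≤⟨ +-monoˡ-≤ y w≤x ⟩
    x + y  ≈⟨ +-comm x y ⟩
    y + x  ≤⟨ +-monoˡ-≤ x y≤z ⟩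
    z + x  ≈⟨ +-comm z x ⟩
    x + z  ∎

  x+z-z≈x : ∀ x z → x + z + - z ≈ x
  x+z-z≈x x z = ≈-trans (+-assoc x z (- z)) (≈-trans (+-congˡ (-‿inverseʳ z)) (+-identityʳ x))

  x-z+z≈x : ∀ x z → x - z + z ≈ x
  x-z+z≈x x z = ≈-trans (+-assoc x (- z) z) (≈-trans (+-congˡ (-‿inverseˡ z)) (+-identityʳ x))

  +-cancelʳ-≤ : ∀ z {x y} → x + z ≤ y + z → x ≤ y
  +-cancelʳ-≤ z {x} {y} x+z≤y+z = begin
    x            ≈⟨ x+z-z≈x x z ⟨
    x + z + - z  ≤⟨ +-monoˡ-≤ (- z) x+z≤y+z ⟩
    y + z + - z  ≈⟨ x+z-z≈x y z ⟩
    y            ∎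

  x≤y+x : ∀ {x y} → 0# ≤ y → x ≤ y + x
  x≤y+x {x} 0≤y = ≤-respˡ-≈ (+-identityˡ x) (+-monoˡ-≤ x 0≤y)

  *-monoˡ-≤ : ∀ {x y z} → 0# ≤ z → x ≤ y → x * z ≤ y * z
  *-monoˡ-≤ {x} {y} {z} 0≤z x≤y = begin
    x * z                ≤⟨ x≤y+x (*-nonNegative 0≤y-x 0≤z) ⟩
    (y - x) * z + x * z  ≈⟨ distribʳ z (y - x) x ⟨
    (y - x + x) * z      ≈⟨ *-congʳ (x-z+z≈x y x) ⟩
    y * z                ∎
    where
    0≤y-x : 0# ≤ y - x
    0≤y-x = ≤-respˡ-≈ (-‿inverseʳ x) (+-monoˡ-≤ (- x) x≤y)

  *-monoʳ-≤ : ∀ {x y z} → 0# ≤ z → x ≤ y → z * x ≤ z * y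
  *-monoʳ-≤ {x} {y} {z} 0≤z x≤y = begin
    z * x  ≈⟨ *-comm z x ⟩
    x * z  ≤⟨ *-monoˡ-≤ 0≤z x≤y ⟩
    y * z  ≈⟨ *-comm y z ⟩
    z * y  ∎

  x²-nonNegative : ∀ x → 0# ≤ x * x
  x²-nonNegative x with ≤-total 0# x
  ... | inj₁ 0≤x = *-nonNegative 0≤x 0≤x
  ... | inj₂ x≤0 = +-cancelʳ-≤ (x * - x) (begin
    0# + x * - x     ≈⟨ +-identityˡ (x * - x) ⟩
    x * - x          ≤⟨ *-monoˡ-≤ 0≤-x x≤0 ⟩
    0# * - x         ≈⟨ zeroˡ (- x) ⟩
    0#               ≈⟨ zeroʳ x ⟨
    x * 0#           ≈⟨ *-congˡ (-‿inverseʳ x) ⟨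
    x * (x + - x)    ≈⟨ distribˡ x x (- x) ⟩
    x * x + x * - x  ∎)
    where
    0≤-x : 0# ≤ - x
    0≤-x = +-cancelʳ-≤ x (≤-respˡ-≈ (≈-sym (+-identityˡ x)) (≤-respʳ-≈ (≈-sym (-‿inverseˡ x)) x≤0))

  0≤1 : 0# ≤ 1#
  0≤1 = ≤-respʳ-≈ (*-identityˡ 1#) (x²-nonNegative 1#)

  1≰0 : ¬ 1# ≤ 0#
  1≰0 1≤0 = 0≉1 (≤-antisym 0≤1 1≤0)

  -- With `1# ≤ z` no inverse is involved: if `y ≤ x`, then x - y ≤ (x - y)z ≤ 0.
  *-cancelʳ-≤ : ∀ {x y z} → 1# ≤ z → x * z ≤ y * z → x ≤ y
  *-cancelʳ-≤ {x} {y} {z} 1≤z xz≤yz with ≤-total x y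
  ... | inj₁ x≤y = x≤y
  ... | inj₂ y≤x = +-cancelʳ-≤ (- y) (begin
    x - y        ≈⟨ *-identityʳ (x - y) ⟨
    (x - y) * 1# ≤⟨ *-monoʳ-≤ (≤-respˡ-≈ (-‿inverseʳ y) (+-monoˡ-≤ (- y) y≤x)) 1≤z ⟩
    (x - y) * z  ≤⟨ +-cancelʳ-≤ (y * z) (begin
      (x - y) * z + y * z  ≈⟨ distribʳ z (x - y) y ⟨
      (x - y + y) * z      ≈⟨ *-congʳ (x-z+z≈x x y) ⟩
      x * z                ≤⟨ xz≤yz ⟩
      y * z                ≈⟨ +-identityˡ (y * z) ⟨
      0# + y * z           ∎) ⟩
    0#           ≈⟨ -‿inverseʳ y ⟨
    y - y        ∎)

  ^-nonNegative : ∀ {x} n → 0# ≤ x → 0# ≤ x ^ n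
  ^-nonNegative zero    0≤x = 0≤1
  ^-nonNegative (suc n) 0≤x = *-nonNegative 0≤x (^-nonNegative n 0≤x)

  ^-≤1 : ∀ {x} n → 0# ≤ x → x ≤ 1# → x ^ n ≤ 1#
  ^-≤1     zero    0≤x x≤1 = ≤-refl
  ^-≤1 {x} (suc n) 0≤x x≤1 = begin
    x * x ^ n   ≤⟨ *-monoˡ-≤ (^-nonNegative n 0≤x) x≤1 ⟩
    1# * x ^ n  ≈⟨ *-identityˡ (x ^ n) ⟩
    x ^ n       ≤⟨ ^-≤1 n 0≤x x≤1 ⟩
    1#          ∎

  ^-antimono-≤ : ∀ {x m n} → 0# ≤ x → x ≤ 1# → m ℕ.≤ n → x ^ n ≤ x ^ m
  ^-antimono-≤ {x} {m} {n} 0≤x x≤1 m≤n = begin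
    x ^ n                  ≡⟨ cong (x ^_) (ℕ.m+[n∸m]≡n m≤n) ⟨
    x ^ (m ℕ.+ (n ℕ.∸ m))  ≈⟨ ^-homo-* x m (n ℕ.∸ m) ⟩
    x ^ m * x ^ (n ℕ.∸ m)  ≤⟨ *-monoʳ-≤ (^-nonNegative m 0≤x) (^-≤1 (n ℕ.∸ m) 0≤x x≤1) ⟩
    x ^ m * 1#             ≈⟨ *-identityʳ (x ^ m) ⟩
    x ^ m                  ∎

  fromℕ-+ : ∀ m n → fromℕ (m ℕ.+ n) ≈ fromℕ m + fromℕ n
  fromℕ-+ = Mult.×-homo-+ +-monoid 1#

  fromℕ-* : ∀ m n → fromℕ (m ℕ.* n) ≈ fromℕ m * fromℕ n
  fromℕ-* = SemiringMult.×1-homo-* semiring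

  0≤fromℕ : ∀ n → 0# ≤ fromℕ n
  0≤fromℕ zero    = ≤-refl
  0≤fromℕ (suc n) = ≤-trans (0≤fromℕ n) (x≤y+x {fromℕ n} 0≤1)

  fromℕ-mono-≤ : ∀ {m n} → m ℕ.≤ n → fromℕ m ≤ fromℕ n
  fromℕ-mono-≤ {n = n} z≤n = 0≤fromℕ n
  fromℕ-mono-≤ (s≤s m≤n) = +-mono-≤ ≤-refl (fromℕ-mono-≤ m≤n)

  -- Upper bounds by a reciprocal are stated as products, here as in `bernoulli` and `decay`, which
  -- keeps inverses out of the estimates.
  x^n*b^n≤1 : ∀ {x b} → 0# ≤ x → x * fromℕ b ≤ 1# → ∀ n → x ^ n * fromℕ (b ℕ.^ n) ≤ 1#
  x^n*b^n≤1 0≤x xb≤1 zero = ≤-reflexive (≈-trans (*-identityˡ _) (+-identityʳ 1#))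
  x^n*b^n≤1 {x} {b} 0≤x xb≤1 (suc n) = begin
    x * x ^ n * fromℕ (b ℕ.* b ℕ.^ n)          ≈⟨ *-congˡ (fromℕ-* b (b ℕ.^ n)) ⟩
    x * x ^ n * (fromℕ b * fromℕ (b ℕ.^ n))    ≈⟨ solve 4 (λ x y b c → x :* y :* (b :* c) := x :* b :* (y :* c)) ≈-refl x (x ^ n) (fromℕ b) _ ⟩
    x * fromℕ b * (x ^ n * fromℕ (b ℕ.^ n))    ≤⟨ *-monoˡ-≤ (*-nonNegative (^-nonNegative n 0≤x) (0≤fromℕ (b ℕ.^ n))) xb≤1 ⟩
    1# * (x ^ n * fromℕ (b ℕ.^ n))             ≈⟨ *-identityˡ _ ⟩
    x ^ n * fromℕ (b ℕ.^ n)                    ≤⟨ x^n*b^n≤1 {x} {b} 0≤x xb≤1 n ⟩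
    1#                                         ∎

  -- `β` bounds the failure probability. If it were at least `ε`, then 2 ≤ nε ≤ βn ≤ 1; the factor 2
  -- is what makes this a contradiction.
  near1 : ∀ {ε P β} n → 0# < ε → fromℕ 2 * ε ⁻¹ ≤ fromℕ n → P ≤ 1# → 1# ≤ P + β → β * fromℕ n ≤ 1# →
          1# - ε < P × P < 1# + ε
  near1 {ε} {P} {β} n (0≤ε , 0≉ε) 2ε⁻¹≤n P≤1 1≤P+β βn≤1 = ≰⇒> lower , ≰⇒> upper
    where
    lower : ¬ P ≤ 1# - ε
    lower P≤1-ε = 1≰0 (+-cancelʳ-≤ 1# (begin
      1# + 1#                 ≈⟨ +-congˡ (+-identityʳ 1#) ⟨
      fromℕ 2                 ≈⟨ *-identityʳ _ ⟨
      fromℕ 2 * 1#            ≈⟨ *-congˡ (≈-trans (*-comm _ _) (⁻¹-inverseʳ λ ε≈0 → 0≉ε (≈-sym ε≈0))) ⟨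
      fromℕ 2 * (ε ⁻¹ * ε)    ≈⟨ *-assoc _ _ _ ⟨
      fromℕ 2 * ε ⁻¹ * ε      ≤⟨ *-monoˡ-≤ 0≤ε 2ε⁻¹≤n ⟩
      fromℕ n * ε             ≈⟨ *-comm _ _ ⟩
      ε * fromℕ n             ≤⟨ *-monoˡ-≤ (0≤fromℕ n) ε≤β ⟩
      β * fromℕ n             ≤⟨ βn≤1 ⟩
      1#                      ≈⟨ +-identityˡ 1# ⟨
      0# + 1#                 ∎))
      where
      ε≤β : ε ≤ β
      ε≤β = +-cancelʳ-≤ (1# - ε) (begin
        ε + (1# - ε)  ≈⟨ +-comm _ _ ⟩
        1# - ε + ε    ≈⟨ x-z+z≈x 1# ε ⟩
        1#            ≤⟨ 1≤P+β ⟩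
        P + β         ≤⟨ +-monoˡ-≤ β P≤1-ε ⟩
        1# - ε + β    ≈⟨ +-comm _ _ ⟩
        β + (1# - ε)  ∎)
    upper : ¬ 1# + ε ≤ P
    upper 1+ε≤P = 0≉ε (≤-antisym 0≤ε (+-cancelʳ-≤ 1# (begin
      ε + 1#   ≈⟨ +-comm _ _ ⟩
      1# + ε   ≤⟨ 1+ε≤P ⟩
      P        ≤⟨ P≤1 ⟩
      1#       ≈⟨ +-identityˡ 1# ⟨
      0# + 1#  ∎)))

  0<18 : 0# < fromℕ 18
  0<18 = ≰⇒> λ 18≤0 → 1≰0 (begin
    1#        ≈⟨ +-identityʳ 1# ⟨
    fromℕ 1   ≤⟨ fromℕ-mono-≤ {1} {18} (s≤s z≤n) ⟩
    fromℕ 18  ≤⟨ 18≤0 ⟩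
    0#        ∎)

  private variable
    A B : Set

  -- Finite sums over lists

  ∑ : (A → Carrier) → List A → Carrier
  ∑ f xs = foldr _+_ 0# (map f xs)

  ∑-cong : ∀ {f g : A → Carrier} → (∀ x → f x ≈ g x) → ∀ xs → ∑ f xs ≈ ∑ g xs
  ∑-cong f≈g []       = ≈-refl
  ∑-cong f≈g (x ∷ xs) = +-cong (f≈g x) (∑-cong f≈g xs)

  ∑-++ : ∀ (f : A → Carrier) xs ys → ∑ f (xs ++ ys) ≈ ∑ f xs + ∑ f ys
  ∑-++ f []       ys = ≈-sym (+-identityˡ _)
  ∑-++ f (x ∷ xs) ys = ≈-trans (+-congˡ (∑-++ f xs ys)) (≈-sym (+-assoc _ _ _))

  ∑-zero : ∀ (xs : List A) → ∑ (λ _ → 0#) xs ≈ 0#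
  ∑-zero []       = ≈-refl
  ∑-zero (x ∷ xs) = ≈-trans (+-identityˡ _) (∑-zero xs)

  ∑-+ : ∀ (f g : A → Carrier) xs → ∑ (λ x → f x + g x) xs ≈ ∑ f xs + ∑ g xs
  ∑-+ f g []       = ≈-sym (+-identityˡ 0#)
  ∑-+ f g (x ∷ xs) = ≈-trans (+-congˡ (∑-+ f g xs))
    (solve 4 (λ a b c d → a :+ b :+ (c :+ d) := a :+ c :+ (b :+ d)) ≈-refl (f x) (g x) (∑ f xs) (∑ g xs))

  *-distribˡ-∑ : ∀ c (f : A → Carrier) xs → ∑ (λ x → c * f x) xs ≈ c * ∑ f xs
  *-distribˡ-∑ c f []       = ≈-sym (zeroʳ c)
  *-distribˡ-∑ c f (x ∷ xs) = ≈-trans (+-congˡ (*-distribˡ-∑ c f xs)) (≈-sym (distribˡ c (f x) (∑ f xs)))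

  *-distribʳ-∑ : ∀ c (f : A → Carrier) xs → ∑ (λ x → f x * c) xs ≈ ∑ f xs * c
  *-distribʳ-∑ c f xs = ≈-trans (∑-cong (λ x → *-comm (f x) c) xs) (≈-trans (*-distribˡ-∑ c f xs) (*-comm c _))

  ∑-swap : ∀ (f : A → B → Carrier) xs ys → ∑ (λ x → ∑ (f x) ys) xs ≈ ∑ (λ y → ∑ (λ x → f x y) xs) ys
  ∑-swap f []       ys = ≈-sym (∑-zero ys)
  ∑-swap f (x ∷ xs) ys = ≈-trans (+-congˡ (∑-swap f xs ys)) (≈-sym (∑-+ (f x) _ ys))

  ∑-map : ∀ (f : B → Carrier) (g : A → B) xs → ∑ f (map g xs) ≈ ∑ (λ x → f (g x)) xs
  ∑-map f g []       = ≈-refl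
  ∑-map f g (x ∷ xs) = +-congˡ (∑-map f g xs)

  ∑-cartesianProductWith : ∀ {C : Set} (f : C → Carrier) (g : A → B → C) xs ys →
    ∑ f (cartesianProductWith g xs ys) ≈ ∑ (λ x → ∑ (λ y → f (g x y)) ys) xs
  ∑-cartesianProductWith f g []       ys = ≈-refl
  ∑-cartesianProductWith f g (x ∷ xs) ys = ≈-trans (∑-++ f (map (g x) ys) _)
    (+-cong (∑-map f (g x) ys) (∑-cartesianProductWith f g xs ys))

  ∑-nonNegative : ∀ {f : A → Carrier} → (∀ x → 0# ≤ f x) → ∀ xs → 0# ≤ ∑ f xs
  ∑-nonNegative 0≤f []       = ≤-refl
  ∑-nonNegative 0≤f (x ∷ xs) = ≤-trans (∑-nonNegative 0≤f xs) (x≤y+x (0≤f x))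

  term≤∑ : ∀ {f : A → Carrier} → (∀ x → 0# ≤ f x) → ∀ {x xs} → x ∈ₗ xs → f x ≤ ∑ f xs
  term≤∑ 0≤f {x} {_ ∷ xs} (here refl) = ≤-respˡ-≈ (+-identityʳ _) (+-mono-≤ ≤-refl (∑-nonNegative 0≤f xs))
  term≤∑ 0≤f {x} {y ∷ xs} (there x∈)  = ≤-trans (term≤∑ 0≤f x∈) (x≤y+x (0≤f y))

  ∑≤length*bound : ∀ {f : A → Carrier} {c xs} → All (λ x → f x ≤ c) xs → ∑ f xs ≤ fromℕ (length xs) * c
  ∑≤length*bound {c = c} [] = ≤-reflexive (≈-sym (zeroˡ c))
  ∑≤length*bound {f = f} {c} {x ∷ xs} (fx≤c ∷ f≤c) = begin
    f x + ∑ f xs                    ≤⟨ +-mono-≤ fx≤c (∑≤length*bound f≤c) ⟩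
    c + fromℕ (length xs) * c       ≈⟨ +-congʳ (*-identityˡ c) ⟨
    1# * c + fromℕ (length xs) * c  ≈⟨ distribʳ c 1# _ ⟨
    (1# + fromℕ (length xs)) * c    ∎

  module _ {P : Pred A 0ℓ} (P? : Decidable P) {f : A → Carrier} where

    ∑-filter≤∑ : (∀ x → 0# ≤ f x) → ∀ xs → ∑ f (filter P? xs) ≤ ∑ f xs
    ∑-filter≤∑ 0≤f []       = ≤-refl
    ∑-filter≤∑ 0≤f (x ∷ xs) with P? x
    ... | yes _ = +-mono-≤ ≤-refl (∑-filter≤∑ 0≤f xs)
    ... | no  _ = ≤-trans (∑-filter≤∑ 0≤f xs) (x≤y+x (0≤f x))

    -- The skeleton of the union bound: terms outside `P` are paid for by `g`, and inside `P` adding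
    -- `g` does no harm since it is nonnegative.
    ∑≤∑-filter+∑ : ∀ {g} → (∀ x → 0# ≤ g x) → (∀ x → ¬ P x → f x ≤ g x) →
                   ∀ xs → ∑ f xs ≤ ∑ f (filter P? xs) + ∑ g xs
    ∑≤∑-filter+∑ 0≤g f≤g [] = ≤-reflexive (≈-sym (+-identityˡ 0#))
    ∑≤∑-filter+∑ {g} 0≤g f≤g (x ∷ xs) with P? x
    ... | yes _  = begin
      f x + ∑ f xs                                  ≤⟨ +-mono-≤ ≤-refl (∑≤∑-filter+∑ 0≤g f≤g xs) ⟩
      f x + (∑ f (filter P? xs) + ∑ g xs)           ≤⟨ +-mono-≤ ≤-refl (+-mono-≤ ≤-refl (x≤y+x (0≤g x))) ⟩
      f x + (∑ f (filter P? xs) + (g x + ∑ g xs))   ≈⟨ +-assoc _ _ _ ⟨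
      f x + ∑ f (filter P? xs) + (g x + ∑ g xs)     ∎
    ... | no ¬px = begin
      f x + ∑ f xs                                  ≤⟨ +-mono-≤ (f≤g x ¬px) (∑≤∑-filter+∑ 0≤g f≤g xs) ⟩
      g x + (∑ f (filter P? xs) + ∑ g xs)           ≈⟨ solve 3 (λ a b c → a :+ (b :+ c) := b :+ (a :+ c)) ≈-refl (g x) _ _ ⟩
      ∑ f (filter P? xs) + (g x + ∑ g xs)           ∎

  -- The indicator functions of N ∩ S = ∅ and of NoEdges G A B.

  avoids : Subset n → Subset n → Carrier
  avoids []           []            = 1#
  avoids (inside ∷ N) (inside  ∷ S) = 0#
  avoids (inside ∷ N) (outside ∷ S) = avoids N S
  avoids (outside ∷ N) (_      ∷ S) = avoids N S

  private
    infixr 8 _⇒_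
    -- Implication in multiplicative form: the factor `x` counts only when the new vertex belongs to
    -- the set.
    _⇒_ : Side → Carrier → Carrier
    inside  ⇒ x = x
    outside ⇒ x = 1#

  noEdges : Graph n → Subset n → Subset n → Carrier
  noEdges ∅       _       _       = 1#
  noEdges (G ▷ N) (a ∷ A) (b ∷ B) = noEdges G A B * (a ⇒ avoids N B * b ⇒ avoids N A)

  avoids≡1 : ∀ (N S : Subset n) → (∀ x → x ∈ N → ¬ x ∈ S) → avoids N S ≡ 1#
  avoids≡1 []            []            N∩S=∅ = refl
  avoids≡1 (inside  ∷ N) (inside  ∷ S) N∩S=∅ = contradiction here (N∩S=∅ zero here)
  avoids≡1 (inside  ∷ N) (outside ∷ S) N∩S=∅ = avoids≡1 N S λ x x∈N x∈S → N∩S=∅ (suc x) (there x∈N) (there x∈S)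
  avoids≡1 (outside ∷ N) (_       ∷ S) N∩S=∅ = avoids≡1 N S λ x x∈N x∈S → N∩S=∅ (suc x) (there x∈N) (there x∈S)

  avoids-nonNegative : ∀ (N S : Subset n) → 0# ≤ avoids N S
  avoids-nonNegative []            []            = 0≤1
  avoids-nonNegative (inside  ∷ N) (inside  ∷ S) = ≤-refl
  avoids-nonNegative (inside  ∷ N) (outside ∷ S) = avoids-nonNegative N S
  avoids-nonNegative (outside ∷ N) (_       ∷ S) = avoids-nonNegative N S

  ⇒-nonNegative : ∀ a {x} → 0# ≤ x → 0# ≤ a ⇒ x
  ⇒-nonNegative inside  0≤x = 0≤x
  ⇒-nonNegative outside 0≤x = 0≤1

  noEdges-nonNegative : ∀ (G : Graph n) A B → 0# ≤ noEdges G A B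
  noEdges-nonNegative ∅       _       _       = 0≤1
  noEdges-nonNegative (G ▷ N) (a ∷ A) (b ∷ B) = *-nonNegative (noEdges-nonNegative G A B)
    (*-nonNegative (⇒-nonNegative a (avoids-nonNegative N B)) (⇒-nonNegative b (avoids-nonNegative N A)))

  noEdges≈1 : ∀ (G : Graph n) A B → NoEdges G A B → noEdges G A B ≈ 1#
  noEdges≈1 ∅       []      []      _    = ≈-refl
  noEdges≈1 (G ▷ N) (a ∷ A) (b ∷ B) none = ≈-trans
    (*-cong (noEdges≈1 G A B (λ u∈A v∈B → none (there u∈A) (there v∈B)))
            (≈-trans (*-cong (left a none) (right b none)) (*-identityˡ 1#)))
    (*-identityˡ 1#)
    where
    left : ∀ a → NoEdges (G ▷ N) (a ∷ A) (b ∷ B) → a ⇒ avoids N B ≈ 1#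
    left outside _    = ≈-refl
    left inside  none = ≈-reflexive (avoids≡1 N B λ x x∈N x∈B → none here (there x∈B) x∈N)
    right : ∀ b → NoEdges (G ▷ N) (a ∷ A) (b ∷ B) → b ⇒ avoids N A ≈ 1#
    right outside _    = ≈-refl
    right inside  none = ≈-reflexive (avoids≡1 N A λ x x∈N x∈A → none (there x∈A) here x∈N)

  disjoint? : ∀ (A B : Subset n) → Dec (Disjoint A B)
  disjoint? A B = all? λ x → (x ∈? A) →-dec ¬? (x ∈? B)

  Disjoint-∷⁻ : ∀ {a b} {A B : Subset n} → Disjoint (a ∷ A) (b ∷ B) → Disjoint A B
  Disjoint-∷⁻ disjoint x x∈A x∈B = disjoint (suc x) (there x∈A) (there x∈B)

  ∈-allSubsets : ∀ (A : Subset n) → A ∈ₗ allSubsets n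
  ∈-allSubsets []            = here refl
  ∈-allSubsets (inside  ∷ A) = ∈-cartesianProductWith⁺ _∷_ {xs = inside ∷ outside ∷ []} (here refl) (∈-allSubsets A)
  ∈-allSubsets (outside ∷ A) = ∈-cartesianProductWith⁺ _∷_ {xs = inside ∷ outside ∷ []} (there (here refl)) (∈-allSubsets A)

  length-cartesianProductWith : ∀ {C : Set} (g : A → B → C) xs ys →
    length (cartesianProductWith g xs ys) ≡ length xs ℕ.* length ys
  length-cartesianProductWith g []       ys = refl
  length-cartesianProductWith g (x ∷ xs) ys = trans (length-++ (map (g x) ys))
    (cong₂ ℕ._+_ (length-map (g x) ys) (length-cartesianProductWith g xs ys))

  length-allSubsets : ∀ n → length (allSubsets n) ≡ 2 ℕ.^ n
  length-allSubsets zero    = refl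
  length-allSubsets (suc n) = trans (length-cartesianProductWith _∷_ (inside ∷ outside ∷ []) (allSubsets n))
    (cong (2 ℕ.*_) (length-allSubsets n))

  -- Expectations in the random graph

  module _ {p} (0≤p : 0# ≤ p) (p≤1 : p ≤ 1#) where

    q : Carrier
    q = 1# - p

    p+q≈1 : p + q ≈ 1#
    p+q≈1 = ≈-trans (+-comm p q) (x-z+z≈x 1# p)

    0≤q : 0# ≤ q
    0≤q = ≤-respˡ-≈ (-‿inverseʳ p) (+-monoˡ-≤ (- p) p≤1)

    q≤1 : q ≤ 1#
    q≤1 = ≤-respʳ-≈ p+q≈1 (x≤y+x 0≤p)

    subsetWeight-nonNegative : ∀ (N : Subset n) → 0# ≤ subsetWeight p N
    subsetWeight-nonNegative []            = 0≤1
    subsetWeight-nonNegative (inside  ∷ N) = *-nonNegative 0≤p (subsetWeight-nonNegative N)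
    subsetWeight-nonNegative (outside ∷ N) = *-nonNegative 0≤q (subsetWeight-nonNegative N)

    weight-nonNegative : ∀ (G : Graph n) → 0# ≤ weight p G
    weight-nonNegative ∅       = 0≤1
    weight-nonNegative (G ▷ N) = *-nonNegative (weight-nonNegative G) (subsetWeight-nonNegative N)

    ∑-subsets-suc : ∀ n (f : Subset (suc n) → Carrier) →
      ∑ f (allSubsets (suc n)) ≈ ∑ (λ N → f (inside ∷ N)) (allSubsets n) + ∑ (λ N → f (outside ∷ N)) (allSubsets n)
    ∑-subsets-suc n f = ≈-trans (∑-cartesianProductWith f _∷_ (inside ∷ outside ∷ []) (allSubsets n))
      (+-congˡ (+-identityʳ _))

    ∑-subsetWeight : ∀ n → ∑ (subsetWeight p) (allSubsets n) ≈ 1#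
    ∑-subsetWeight zero    = +-identityʳ 1#
    ∑-subsetWeight (suc n) = begin-equality
      ∑ (subsetWeight p) (allSubsets (suc n))  ≈⟨ ∑-subsets-suc n (subsetWeight p) ⟩
      ∑ (λ N → p * subsetWeight p N) (allSubsets n) + ∑ (λ N → q * subsetWeight p N) (allSubsets n)
        ≈⟨ +-cong (*-distribˡ-∑ p _ (allSubsets n)) (*-distribˡ-∑ q _ (allSubsets n)) ⟩
      p * ∑ (subsetWeight p) (allSubsets n) + q * ∑ (subsetWeight p) (allSubsets n)
        ≈⟨ distribʳ _ p q ⟨
      (p + q) * ∑ (subsetWeight p) (allSubsets n)  ≈⟨ *-cong p+q≈1 (∑-subsetWeight n) ⟩
      1# * 1#                                      ≈⟨ *-identityˡ 1# ⟩
      1#                                           ∎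

    -- The probability that a random neighbourhood misses `S`: each element of `S` contributes `q`,
    -- every other vertex contributes p + q = 1.
    ∑-avoids : ∀ (S : Subset n) → ∑ (λ N → subsetWeight p N * avoids N S) (allSubsets n) ≈ q ^ ∣ S ∣
    ∑-avoids []                    = ≈-trans (+-identityʳ _) (*-identityˡ 1#)
    ∑-avoids {suc n} (inside  ∷ S) = begin-equality
      _ ≈⟨ ∑-subsets-suc n (λ N → subsetWeight p N * avoids N (inside ∷ S)) ⟩
      ∑ (λ N → p * subsetWeight p N * 0#) (allSubsets n) + ∑ (λ N → q * subsetWeight p N * avoids N S) (allSubsets n)
        ≈⟨ +-cong (≈-trans (∑-cong (λ N → zeroʳ _) (allSubsets n)) (∑-zero (allSubsets n)))
                  (≈-trans (∑-cong (λ N → *-assoc q _ _) (allSubsets n)) (*-distribˡ-∑ q _ (allSubsets n))) ⟩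
      0# + q * ∑ (λ N → subsetWeight p N * avoids N S) (allSubsets n)
        ≈⟨ ≈-trans (+-identityˡ _) (*-congˡ (∑-avoids S)) ⟩
      q * q ^ ∣ S ∣ ∎
    ∑-avoids {suc n} (outside ∷ S) = begin-equality
      _ ≈⟨ ∑-subsets-suc n (λ N → subsetWeight p N * avoids N (outside ∷ S)) ⟩
      ∑ (λ N → p * subsetWeight p N * avoids N S) (allSubsets n) + ∑ (λ N → q * subsetWeight p N * avoids N S) (allSubsets n)
        ≈⟨ +-cong (≈-trans (∑-cong (λ N → *-assoc p _ _) (allSubsets n)) (*-distribˡ-∑ p _ (allSubsets n)))
                  (≈-trans (∑-cong (λ N → *-assoc q _ _) (allSubsets n)) (*-distribˡ-∑ q _ (allSubsets n))) ⟩
      p * ∑ (λ N → subsetWeight p N * avoids N S) (allSubsets n) + q * ∑ (λ N → subsetWeight p N * avoids N S) (allSubsets n)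
        ≈⟨ distribʳ _ p q ⟨
      (p + q) * ∑ (λ N → subsetWeight p N * avoids N S) (allSubsets n)
        ≈⟨ *-cong p+q≈1 (∑-avoids S) ⟩
      1# * q ^ ∣ S ∣  ≈⟨ *-identityˡ _ ⟩
      q ^ ∣ S ∣       ∎

    -- Independence of the new neighbourhood from the graph built so far.
    ∑-graphs-suc : ∀ (f : Graph n → Carrier) (g : Subset n → Carrier) (h : Graph (suc n) → Carrier) →
      (∀ G N → h (G ▷ N) ≈ f G * g N) →
      ∑ h (allGraphs (suc n)) ≈ ∑ f (allGraphs n) * ∑ g (allSubsets n)
    ∑-graphs-suc {n} f g h h≈fg = begin-equality
      ∑ h (allGraphs (suc n))
        ≈⟨ ∑-cartesianProductWith h _▷_ (allGraphs n) (allSubsets n) ⟩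
      ∑ (λ G → ∑ (λ N → h (G ▷ N)) (allSubsets n)) (allGraphs n)
        ≈⟨ ∑-cong (λ G → ≈-trans (∑-cong (h≈fg G) (allSubsets n)) (*-distribˡ-∑ (f G) g (allSubsets n))) (allGraphs n) ⟩
      ∑ (λ G → f G * ∑ g (allSubsets n)) (allGraphs n)
        ≈⟨ *-distribʳ-∑ _ f (allGraphs n) ⟩
      ∑ f (allGraphs n) * ∑ g (allSubsets n)  ∎

    ∑-weight : ∀ n → ∑ (weight p) (allGraphs n) ≈ 1#
    ∑-weight zero    = +-identityʳ 1#
    ∑-weight (suc n) = begin-equality
      _ ≈⟨ ∑-graphs-suc {n} (weight p) (subsetWeight p) (weight p) (λ _ _ → ≈-refl) ⟩
      _ ≈⟨ *-cong (∑-weight n) (∑-subsetWeight n) ⟩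
      _ ≈⟨ *-identityˡ 1# ⟩
      1# ∎

    -- Disjointness puts the new vertex into at most one of the two sets. It then contributes
    -- `q ^ ∣ B ∣`, `q ^ ∣ A ∣` or 1, exactly the growth of the product of the sizes.
    ∑-noEdges : ∀ (A B : Subset n) → Disjoint A B →
      ∑ (λ G → weight p G * noEdges G A B) (allGraphs n) ≈ q ^ (∣ A ∣ ℕ.* ∣ B ∣)
    ∑-noEdges []      []      _        = ≈-trans (+-identityʳ _) (*-identityˡ 1#)
    ∑-noEdges {suc n} (a ∷ A) (b ∷ B) disjoint = begin-equality
      _ ≈⟨ ∑-graphs-suc {n} (λ G → weight p G * noEdges G A B) (λ N → subsetWeight p N * (a ⇒ avoids N B * b ⇒ avoids N A)) _
             (λ G N → solve 4 (λ w s e γ → w :* s :* (e :* γ) := w :* e :* (s :* γ)) ≈-refl (weight p G) (subsetWeight p N) (noEdges G A B) _) ⟩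
      _ ≈⟨ *-congʳ (∑-noEdges A B (Disjoint-∷⁻ disjoint)) ⟩
      q ^ (∣ A ∣ ℕ.* ∣ B ∣) * ∑ (λ N → subsetWeight p N * (a ⇒ avoids N B * b ⇒ avoids N A)) (allSubsets n)
        ≈⟨ newVertex a b disjoint ⟩
      q ^ (∣ a ∷ A ∣ ℕ.* ∣ b ∷ B ∣) ∎
      where
      newVertex : ∀ a b → Disjoint (a ∷ A) (b ∷ B) →
        q ^ (∣ A ∣ ℕ.* ∣ B ∣) * ∑ (λ N → subsetWeight p N * (a ⇒ avoids N B * b ⇒ avoids N A)) (allSubsets n)
        ≈ q ^ (∣ a ∷ A ∣ ℕ.* ∣ b ∷ B ∣)
      newVertex inside  inside  disjoint = contradiction here (disjoint zero here)
      newVertex inside  outside _ = begin-equality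
        _ ≈⟨ *-congˡ (≈-trans (∑-cong (λ N → *-congˡ (*-identityʳ _)) (allSubsets n)) (∑-avoids B)) ⟩
        q ^ (∣ A ∣ ℕ.* ∣ B ∣) * q ^ ∣ B ∣   ≈⟨ *-comm _ _ ⟩
        q ^ ∣ B ∣ * q ^ (∣ A ∣ ℕ.* ∣ B ∣)   ≈⟨ ^-homo-* q ∣ B ∣ (∣ A ∣ ℕ.* ∣ B ∣) ⟨
        q ^ (∣ B ∣ ℕ.+ ∣ A ∣ ℕ.* ∣ B ∣)     ∎
      newVertex outside inside  _ = begin-equality
        _ ≈⟨ *-congˡ (≈-trans (∑-cong (λ N → *-congˡ (*-identityˡ _)) (allSubsets n)) (∑-avoids A)) ⟩
        q ^ (∣ A ∣ ℕ.* ∣ B ∣) * q ^ ∣ A ∣   ≈⟨ *-comm _ _ ⟩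
        q ^ ∣ A ∣ * q ^ (∣ A ∣ ℕ.* ∣ B ∣)   ≈⟨ ^-homo-* q ∣ A ∣ (∣ A ∣ ℕ.* ∣ B ∣) ⟨
        q ^ (∣ A ∣ ℕ.+ ∣ A ∣ ℕ.* ∣ B ∣)     ≡⟨ cong (q ^_) (ℕ.*-suc ∣ A ∣ ∣ B ∣) ⟨
        q ^ (∣ A ∣ ℕ.* suc ∣ B ∣)           ∎
      newVertex outside outside _ = begin-equality
        _ ≈⟨ *-congˡ (≈-trans (∑-cong (λ N → ≈-trans (*-congˡ (*-identityˡ 1#)) (*-identityʳ _)) (allSubsets n)) (∑-subsetWeight n)) ⟩
        q ^ (∣ A ∣ ℕ.* ∣ B ∣) * 1#  ≈⟨ *-identityʳ _ ⟩
        q ^ (∣ A ∣ ℕ.* ∣ B ∣)       ∎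

    -- The first-moment bound

    Pr≤1 : ∀ {E : Pred (Graph n) 0ℓ} (E? : Decidable E) → Pr p E? ≤ 1#
    Pr≤1 {n} E? = ≤-respʳ-≈ (∑-weight n) (∑-filter≤∑ E? weight-nonNegative (allGraphs n))

    Pr-unionBound : ∀ {E : Pred (Graph n) 0ℓ} (E? : Decidable E) m →
      (∀ G → ¬ E G → ∃₂ λ A B → NoEdges G A B × Disjoint A B × m ℕ.≤ ∣ A ∣ × m ℕ.≤ ∣ B ∣) →
      1# ≤ Pr p E? + fromℕ (2 ℕ.^ n ℕ.* 2 ℕ.^ n) * q ^ (m ℕ.* m)
    Pr-unionBound {n} E? m separated = begin
      1#                                ≈⟨ ∑-weight n ⟨
      ∑ (weight p) (allGraphs n)        ≤⟨ ∑≤∑-filter+∑ E? g-nonNegative w≤g (allGraphs n) ⟩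
      Pr p E? + ∑ g (allGraphs n)       ≤⟨ +-mono-≤ ≤-refl ∑g≤ ⟩
      Pr p E? + fromℕ (2 ℕ.^ n ℕ.* 2 ℕ.^ n) * q ^ (m ℕ.* m)  ∎
      where
      Large : Pred (Subset n × Subset n) 0ℓ
      Large (A , B) = Disjoint A B × m ℕ.≤ ∣ A ∣ × m ℕ.≤ ∣ B ∣

      large? : Decidable Large
      large? (A , B) = disjoint? A B ×-dec ((m ℕ.≤? ∣ A ∣) ×-dec (m ℕ.≤? ∣ B ∣))

      allPairs largePairs : List (Subset n × Subset n)
      allPairs   = cartesianProduct (allSubsets n) (allSubsets n)
      largePairs = filter large? allPairs

      s : Graph n → Subset n × Subset n → Carrier
      s G (A , B) = noEdges G A B

      s-nonNegative : ∀ G P → 0# ≤ s G P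
      s-nonNegative G (A , B) = noEdges-nonNegative G A B

      -- The weight times the number of large edgeless pairs, so that its sum is the expected number
      -- of such pairs. A graph outside `E` has at least one.
      g : Graph n → Carrier
      g G = weight p G * ∑ (s G) largePairs

      g-nonNegative : ∀ G → 0# ≤ g G
      g-nonNegative G = *-nonNegative (weight-nonNegative G) (∑-nonNegative (s-nonNegative G) largePairs)

      w≤g : ∀ G → ¬ _ → weight p G ≤ g G
      w≤g G ¬EG with A , B , none , large ← separated G ¬EG = begin
        weight p G                    ≈⟨ *-identityʳ _ ⟨
        weight p G * 1#               ≈⟨ *-congˡ (noEdges≈1 G A B none) ⟨
        weight p G * noEdges G A B    ≤⟨ *-monoʳ-≤ (weight-nonNegative G) (term≤∑ (s-nonNegative G)
          (∈-filter⁺ large? (∈-cartesianProduct⁺ (∈-allSubsets A) (∈-allSubsets B)) large)) ⟩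
        weight p G * ∑ (s G) largePairs  ∎

      expectation≤ : ∀ {P} → Large P → ∑ (λ G → weight p G * s G P) (allGraphs n) ≤ q ^ (m ℕ.* m)
      expectation≤ {A , B} (disjoint , m≤A , m≤B) = ≤-respˡ-≈ (≈-sym (∑-noEdges A B disjoint))
        (^-antimono-≤ 0≤q q≤1 (ℕ.*-mono-≤ m≤A m≤B))

      length≤ : length largePairs ℕ.≤ 2 ℕ.^ n ℕ.* 2 ℕ.^ n
      length≤ = ℕ.≤-trans (length-filter large? allPairs) (ℕ.≤-reflexive
        (trans (length-cartesianProductWith _,_ (allSubsets n) (allSubsets n))
                 (cong₂ ℕ._*_ (length-allSubsets n) (length-allSubsets n))))

      ∑g≤ : ∑ g (allGraphs n) ≤ fromℕ (2 ℕ.^ n ℕ.* 2 ℕ.^ n) * q ^ (m ℕ.* m)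
      ∑g≤ = begin
        ∑ g (allGraphs n)
          ≈⟨ ∑-cong (λ G → *-distribˡ-∑ (weight p G) (s G) largePairs) (allGraphs n) ⟨
        ∑ (λ G → ∑ (λ P → weight p G * s G P) largePairs) (allGraphs n)
          ≈⟨ ∑-swap (λ G P → weight p G * s G P) (allGraphs n) largePairs ⟩
        ∑ (λ P → ∑ (λ G → weight p G * s G P) (allGraphs n)) largePairs
          ≤⟨ ∑≤length*bound (All.map expectation≤ (all-filter large? allPairs)) ⟩
        fromℕ (length largePairs) * q ^ (m ℕ.* m)
          ≤⟨ *-monoˡ-≤ (^-nonNegative (m ℕ.* m) 0≤q) (fromℕ-mono-≤ length≤) ⟩
        fromℕ (2 ℕ.^ n ℕ.* 2 ℕ.^ n) * q ^ (m ℕ.* m)  ∎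

    -- A substitute for q^k ≤ exp(-kp). In the step, Y = 1 + (k + 1)p satisfies qY = Y - pY ≤ Y - p,
    -- because 1 ≤ Y.
    bernoulli : ∀ k → q ^ k * (1# + fromℕ k * p) ≤ 1#
    bernoulli zero    = ≤-reflexive (≈-trans (*-identityˡ _) (≈-trans (+-congˡ (zeroˡ p)) (+-identityʳ 1#)))
    bernoulli (suc k) = begin
      q * Q * (1# + (1# + K) * p)      ≈⟨ solve 5 (λ q Q o K p → q :* Q :* (o :+ (o :+ K) :* p) := Q :* (q :* (o :+ K :* p :+ o :* p))) ≈-refl _ Q 1# K p ⟩
      Q * (q * (1# + K * p + 1# * p))  ≤⟨ *-monoʳ-≤ (^-nonNegative k 0≤q) shrink ⟩
      Q * (1# + K * p)                 ≤⟨ bernoulli k ⟩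
      1#                               ∎
      where
      Q = q ^ k
      K = fromℕ k
      Y = 1# + K * p + 1# * p
      1≤Y : 1# ≤ Y
      1≤Y = begin
        1#                     ≤⟨ x≤y+x (*-nonNegative (0≤fromℕ k) 0≤p) ⟩
        K * p + 1#             ≈⟨ +-comm _ _ ⟩
        1# + K * p             ≤⟨ x≤y+x (*-nonNegative 0≤1 0≤p) ⟩
        1# * p + (1# + K * p)  ≈⟨ +-comm _ _ ⟩
        Y                      ∎
      shrink : q * Y ≤ 1# + K * p
      shrink = +-cancelʳ-≤ (1# * p) (begin
        q * Y + 1# * p  ≤⟨ +-mono-≤ ≤-refl (*-monoˡ-≤ 0≤p 1≤Y) ⟩
        q * Y + Y * p   ≈⟨ +-congˡ (*-comm Y p) ⟩
        q * Y + p * Y   ≈⟨ distribʳ Y _ p ⟨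
        (q + p) * Y     ≈⟨ *-congʳ (x-z+z≈x 1# p) ⟩
        1# * Y          ≈⟨ *-identityˡ Y ⟩
        Y               ∎)

    np≤n : ∀ n → fromℕ n * p ≤ fromℕ n
    np≤n n = ≤-respʳ-≈ (*-identityʳ _) (*-monoʳ-≤ (0≤fromℕ n) p≤1)

    -- The factor 8ⁿ = 4ⁿ · 2ⁿ pays for the 4ⁿ pairs and, as n ≤ 2ⁿ, for the factor n.
    decay : ∀ n m → 1# ≤ fromℕ n → fromℕ 9 * fromℕ n ≤ fromℕ m * p →
            fromℕ (2 ℕ.^ n ℕ.* 2 ℕ.^ n) * q ^ m * fromℕ n ≤ 1#
    decay zero    m 1≤0 = contradiction 1≤0 1≰0
    decay n@(suc _) m 1≤n 9n≤mp = begin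
      S * q ^ m * fromℕ n                              ≤⟨ *-monoʳ-≤ (*-nonNegative (0≤fromℕ (2 ℕ.^ n ℕ.* 2 ℕ.^ n)) (^-nonNegative m 0≤q)) (fromℕ-mono-≤ (n≤2^n n)) ⟩
      S * q ^ m * fromℕ (2 ℕ.^ n)                      ≈⟨ solve 3 (λ s q t → s :* q :* t := q :* (s :* t)) ≈-refl S _ _ ⟩
      q ^ m * (S * fromℕ (2 ℕ.^ n))                    ≈⟨ *-congˡ (fromℕ-* (2 ℕ.^ n ℕ.* 2 ℕ.^ n) (2 ℕ.^ n)) ⟨
      q ^ m * fromℕ (2 ℕ.^ n ℕ.* 2 ℕ.^ n ℕ.* 2 ℕ.^ n)  ≡⟨ cong (λ x → q ^ m * fromℕ x) (2ⁿ*2ⁿ*2ⁿ≡8ⁿ n) ⟩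
      q ^ m * fromℕ (8 ℕ.^ n)                          ≤⟨ *-monoˡ-≤ (0≤fromℕ (8 ℕ.^ n)) (^-antimono-≤ 0≤q q≤1 (m/n*n≤m m n)) ⟩
      q ^ (k ℕ.* n) * fromℕ (8 ℕ.^ n)                  ≈⟨ *-congʳ (^-assocʳ _ k n) ⟨
      (q ^ k) ^ n * fromℕ (8 ℕ.^ n)                    ≤⟨ x^n*b^n≤1 {b = 8} 0≤Q (≤-trans (*-monoʳ-≤ 0≤Q 8≤1+kp) (bernoulli k)) n ⟩
      1#                                               ∎
      where
      S = fromℕ (2 ℕ.^ n ℕ.* 2 ℕ.^ n)
      -- The exponent is cut into `n` blocks of length `k`, each of which contributes a factor of at
      -- most 1/8.
      k = m ℕ./ n
      0≤Q = ^-nonNegative k 0≤q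
      m≤[1+k]n : m ℕ.≤ suc k ℕ.* n
      m≤[1+k]n = subst (ℕ._≤ suc k ℕ.* n) (sym (m≡m%n+[m/n]*n m n)) (ℕ.+-monoˡ-≤ (k ℕ.* n) (ℕ.<⇒≤ (m%n<n m n)))
      -- Rounding `k` down loses at most one `p` ≤ 1, and the summand 1 absorbs it. The hypothesis
      -- has 9 in place of 8 because 9 is a perfect square, which lets the set size be a multiple of
      -- 3.
      8≤1+kp : fromℕ 8 ≤ 1# + fromℕ k * p
      8≤1+kp = ≤-trans (fromℕ-mono-≤ (ℕ.n≤1+n 8)) (≤-trans (*-cancelʳ-≤ 1≤n (begin
        fromℕ 9 * fromℕ n            ≤⟨ 9n≤mp ⟩
        fromℕ m * p                  ≤⟨ *-monoˡ-≤ 0≤p (fromℕ-mono-≤ m≤[1+k]n) ⟩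
        fromℕ (suc k ℕ.* n) * p      ≈⟨ *-congʳ (fromℕ-* (suc k) n) ⟩
        fromℕ (suc k) * fromℕ n * p  ≈⟨ solve 3 (λ a b c → a :* b :* c := a :* c :* b) ≈-refl (fromℕ (suc k)) (fromℕ n) p ⟩
        fromℕ (suc k) * p * fromℕ n  ∎))
        (≤-trans (≤-reflexive (distribʳ p 1# (fromℕ k))) (+-mono-≤ (≤-trans (≤-reflexive (*-identityˡ p)) p≤1) ≤-refl)))

    -- Choice of scale and concentration

    module _ {n} (1≤np : 1# ≤ fromℕ n * p) where

      1≤n : 1# ≤ fromℕ n
      1≤n = ≤-trans 1≤np (np≤n n)

      p≉0 : ¬ p ≈ 0#
      p≉0 p≈0 = 1≰0 (≤-trans 1≤np (≤-reflexive (≈-trans (*-congˡ p≈0) (zeroʳ (fromℕ n)))))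

      0≤p⁻¹ : 0# ≤ p ⁻¹
      0≤p⁻¹ with ≤-total 0# (p ⁻¹)
      ... | inj₁ 0≤p⁻¹ = 0≤p⁻¹
      ... | inj₂ p⁻¹≤0 = contradiction (begin
        1#        ≈⟨ ⁻¹-inverseʳ p≉0 ⟨
        p * p ⁻¹  ≤⟨ *-monoʳ-≤ 0≤p p⁻¹≤0 ⟩
        p * 0#    ≈⟨ zeroʳ p ⟩
        0#        ∎) 1≰0

      -- Such a `y` belongs to the set whose supremum is the root. All estimates of the root go
      -- through this lower bound.
      ≤√[n/p] : ∀ {y} → y * y * p ≤ fromℕ n → y ≤ √ (fromℕ n / p)
      ≤√[n/p] {y} y²p≤n = proj₁ (proj₂ (√-supremum (fromℕ n / p))) (inj₂ (begin
        y * y                ≈⟨ *-identityʳ _ ⟨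
        y * y * 1#           ≈⟨ *-congˡ (⁻¹-inverseʳ p≉0) ⟨
        y * y * (p * p ⁻¹)   ≈⟨ *-assoc _ _ _ ⟨
        y * y * p * p ⁻¹     ≤⟨ *-monoˡ-≤ 0≤p⁻¹ y²p≤n ⟩
        fromℕ n * p ⁻¹       ∎))

      1≤√[n/p] : 1# ≤ √ (fromℕ n / p)
      1≤√[n/p] = ≤√[n/p] (begin
        1# * 1# * p  ≈⟨ ≈-trans (*-congʳ (*-identityˡ 1#)) (*-identityˡ p) ⟩
        p            ≤⟨ p≤1 ⟩
        1#           ≤⟨ 1≤n ⟩
        fromℕ n      ∎)

      -- Rounds √(n/p) to an integer: s < √(n/p) ≤ s + 1. The search may start at `n`, since np ≥ 1
      -- gives n²p ≥ n.
      scale : ∃[ s ] ¬ fromℕ n ≤ fromℕ (s ℕ.* s) * p × fromℕ n ≤ fromℕ (suc s ℕ.* suc s) * p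
      scale = crossing (λ s → fromℕ n ≤? fromℕ (s ℕ.* s) * p)
        (λ n≤0 → 1≰0 (≤-trans 1≤n (≤-trans n≤0 (≤-reflexive (zeroˡ p)))))
        n (begin
          fromℕ n                  ≈⟨ *-identityʳ _ ⟨
          fromℕ n * 1#             ≤⟨ *-monoʳ-≤ (0≤fromℕ n) 1≤np ⟩
          fromℕ n * (fromℕ n * p)  ≈⟨ *-assoc _ _ _ ⟨
          fromℕ n * fromℕ n * p    ≈⟨ *-congʳ (fromℕ-* n n) ⟨
          fromℕ (n ℕ.* n) * p      ∎)

      TdBound : Pred (Graph n) 0ℓ
      TdBound G = fromℕ n - fromℕ 18 * √ (fromℕ n / p) ≤ fromℕ (td G) × fromℕ (td G) ≤ fromℕ n

      -- The witness `β` is the union bound over all large pairs, so the failure probability is at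
      -- most 1/n.
      concentration : (E? : Decidable TdBound) → ∃[ β ] 1# ≤ Pr p E? + β × β * fromℕ n ≤ 1#
      concentration E? = fromScale scale
        where
        fromScale : (∃[ s ] ¬ fromℕ n ≤ fromℕ (s ℕ.* s) * p × fromℕ n ≤ fromℕ (suc s ℕ.* suc s) * p) →
                    ∃[ β ] 1# ≤ Pr p E? + β × β * fromℕ n ≤ 1#
        fromScale (s , below , above) = _ , Pr-unionBound E? m violated , decay n (m ℕ.* m) 1≤n (begin
            fromℕ 9 * fromℕ n                          ≤⟨ *-monoʳ-≤ (0≤fromℕ 9) above ⟩
            fromℕ 9 * (fromℕ (suc s ℕ.* suc s) * p)    ≈⟨ *-assoc _ _ _ ⟨
            fromℕ 9 * fromℕ (suc s ℕ.* suc s) * p      ≈⟨ *-congʳ (fromℕ-* 9 (suc s ℕ.* suc s)) ⟨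
            fromℕ (9 ℕ.* (suc s ℕ.* suc s)) * p        ≡⟨ cong (λ x → fromℕ x * p) (9s²≡m² (suc s)) ⟩
            fromℕ (m ℕ.* m) * p                        ∎)
          where
          -- Then m²p = 9(s + 1)²p ≥ 9n, as `decay` asks. On the other side 3m = 9s + 9, and both
          -- `s` and 1 are at most `r`; this is where the constant 18 comes from.
          m = 3 ℕ.* suc s
          r = √ (fromℕ n / p)

          9s²≡m² : ∀ t → 9 ℕ.* (t ℕ.* t) ≡ 3 ℕ.* t ℕ.* (3 ℕ.* t)
          9s²≡m² = +-*-Solver.solve 1 (λ t → con′ 9 ×′ (t ×′ t) =′ con′ 3 ×′ t ×′ (con′ 3 ×′ t)) refl
            where open +-*-Solver using () renaming (con to con′; _:*_ to _×′_; _:=_ to _=′_)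

          s≤r : fromℕ s ≤ r
          s≤r = ≤√[n/p] (≤-trans (≤-reflexive (*-congʳ (≈-sym (fromℕ-* s s)))) (≰⇒≥ below))

          3m≤18r : fromℕ (3 ℕ.* m) ≤ fromℕ 18 * r
          3m≤18r = begin
            fromℕ (3 ℕ.* (3 ℕ.* suc s))   ≡⟨ cong fromℕ (ℕ.*-assoc 3 3 (suc s)) ⟨
            fromℕ (9 ℕ.* suc s)           ≈⟨ fromℕ-* 9 (suc s) ⟩
            fromℕ 9 * (1# + fromℕ s)      ≤⟨ *-monoʳ-≤ (0≤fromℕ 9) (+-mono-≤ 1≤√[n/p] s≤r) ⟩
            fromℕ 9 * (r + r)             ≈⟨ distribˡ _ r r ⟩
            fromℕ 9 * r + fromℕ 9 * r     ≈⟨ distribʳ r (fromℕ 9) (fromℕ 9) ⟨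
            (fromℕ 9 + fromℕ 9) * r       ≈⟨ *-congʳ (fromℕ-+ 9 9) ⟨
            fromℕ 18 * r                  ∎

          tdBound : ∀ G → ¬ td G ℕ.+ 3 ℕ.* m ℕ.≤ n → TdBound G
          tdBound G td+3m≰n =
              +-cancelʳ-≤ (fromℕ 18 * r) (begin
                fromℕ n - fromℕ 18 * r + fromℕ 18 * r  ≈⟨ x-z+z≈x (fromℕ n) (fromℕ 18 * r) ⟩
                fromℕ n                                ≤⟨ fromℕ-mono-≤ (ℕ.≰⇒≥ td+3m≰n) ⟩
                fromℕ (td G ℕ.+ 3 ℕ.* m)               ≈⟨ fromℕ-+ (td G) (3 ℕ.* m) ⟩
                fromℕ (td G) + fromℕ (3 ℕ.* m)         ≤⟨ +-mono-≤ ≤-refl 3m≤18r ⟩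
                fromℕ (td G) + fromℕ 18 * r            ∎)
            , fromℕ-mono-≤ (td≤n G)

          violated : ∀ G → ¬ TdBound G → ∃₂ λ A B → NoEdges G A B × Disjoint A B × m ℕ.≤ ∣ A ∣ × m ℕ.≤ ∣ B ∣
          violated G ¬bound = td-separation G (s≤s z≤n)
            (decidable-stable (td G ℕ.+ 3 ℕ.* m ℕ.≤? n) λ td+3m≰n → ¬bound (tdBound G td+3m≰n))

theorem1p1 : (ℝ : CompleteOrderedField) → let open ErdősRényi ℝ in
    (p : ℕ → Carrier) →
    (∀ n → 0# ≤ p n × p n ≤ 1#) →
    (λ n → fromℕ n * p n) ⟶∞ →
    ∃[ C ] 0# < C ×
    (λ n → Pr (p n) (λ (G : Graph n) →
    (fromℕ n - C * √ (fromℕ n / p n) ≤? fromℕ (td G)) ×-dec (fromℕ (td G) ≤? fromℕ n))) ⟶ 1#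
theorem1p1 ℝ p 0≤p≤1 np→∞ = fromℕ 18 , 0<18 , λ ε 0<ε →
  -- The growth of np is used at two levels: from 1 on, `p` is invertible and the scale exists; from
  -- 2/ε on, n ≥ np makes the failure probability 1/n smaller than ε.
  let N₁ , 1≤np    = np→∞ 1#
      N₂ , 2ε⁻¹≤np = np→∞ (fromℕ 2 * ε ⁻¹)
  in N₁ ℕ.+ N₂ , λ n N≤n →
    let 0≤p , p≤1 = 0≤p≤1 n
        β , 1≤Pr+β , βn≤1 = concentration 0≤p p≤1 (1≤np n (ℕ.≤-trans (ℕ.m≤m+n N₁ N₂) N≤n)) (E? n)
    in near1 n 0<ε (≤-trans (2ε⁻¹≤np n (ℕ.≤-trans (ℕ.m≤n+m N₂ N₁) N≤n)) (np≤n 0≤p p≤1 n))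
         (Pr≤1 0≤p p≤1 (E? n)) 1≤Pr+β βn≤1
  where
  open ErdősRényi ℝ
  open DecTotalOrder decTotalOrder using () renaming (trans to ≤-trans)
  open EdgeProbability ℝ

  E? : ∀ n → Decidable λ (G : Graph n) →
    fromℕ n - fromℕ 18 * √ (fromℕ n / p n) ≤ fromℕ (td G) × fromℕ (td G) ≤ fromℕ n
  E? n G = (fromℕ n - fromℕ 18 * √ (fromℕ n / p n) ≤? fromℕ (td G)) ×-dec (fromℕ (td G) ≤? fromℕ n)
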